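{- For $m=4$ machines, consider the two-solution ordinal algorithm with the following two solutions. First solution: machine $1$ gets $\{8k+1:k\ge 0\}$; machine $2$ gets $\{8k+2:k\ge 0\}$; machine $3$ gets $\{8k+3:k\ge 0\}\cup\{8k+6:k\ge 0\}\cup\{8k:k\ge 1\}$; machine $4$ gets $\{8k+4:k\ge 0\}\cup\{8k+5:k\ge 0\}\cup\{8k+7:k\ge 0\}$. Second solution: machine $1$ gets $\{1\}\cup\{4k:k\ge 2\}$; machine $2$ gets $\{2\}\cup\{4k-1:k\ge 2\}$; machine $3$ gets $\{3\}\cup\{4k-2:k\ge 2\}$; machine $4$ gets $\{4\}\cup\{4k-3:k\ge 2\}$. The competitive ratio of this algorithm is at most $1.375$.
   Context: Ordinal makespan scheduling on $m$ identical machines. Jobs are indexed by positive integers. A realization is a sequence of real job sizes $p_1\ge p_2\ge p_3\ge\cdots\ge 0$ with only finitely many positive sizes. A solution is a partition of the set of all positive integers into $m$ sets $J_1,\dots,J_m$, where $J_i$ is the set of jobs assigned to machine $i$; it is fixed without knowledge of the realization. For a realization, the load of machine $i$ in the solution is $\sum_{j\in J_i}p_j$, and the completion time of the solution is the maximum load of any machine. A two-solution ordinal algorithm consists of two solutions; its makespan for a realization is the minimum of the completion times of its two solutions for that realization. The optimal offline completion time $\lambda$ of a realization is the minimum completion time over all solutions (chosen with full knowledge of the realization). The competitive ratio of the algorithm is the supremum, over all realizations with $\lambda>0$, of the ratio between its makespan and $\lambda$. -}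

module Defs where

open import Data.Nat as ℕ using (ℕ; zero; suc; NonZero)
import Data.Nat.Properties as ℕ
open import Data.Nat.DivMod using (_/_; _%_; m≡m%n+[m/n]*n; m%n<n; [m+kn]%n≡m%n)
open import Data.Rational as ℚ using (ℚ; 0ℚ; 1ℚ; ½; ∣_∣)
import Data.Rational.Properties as ℚ
open import Data.Rational.Solver using (module +-*-Solver)
open import Data.Fin using (Fin; zero; suc; _≟_)
open import Data.Fin.Patterns using (0F; 1F; 2F; 3F)
open import Data.Product using (∃; _×_; _,_; proj₁; proj₂)
open import Data.Sum using (_⊎_; inj₁; inj₂)
open import Data.Bool using (if_then_else_)
open import Function using (_⇔_; mk⇔)
open import Relation.Nullary using (¬_; does; contradiction)
open import Relation.Binary.PropositionalEquality
  using (_≡_; refl; sym; trans; cong; cong₂; subst; subst₂; module ≡-Reasoning)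

------------------------------------------------------------------------
-- Real numbers, as Cauchy sequences of rationals

IsCauchy : (ℕ → ℚ) → Set
IsCauchy x = ∀ ε → 0ℚ ℚ.< ε →
  ∃ λ N → ∀ m n → N ℕ.≤ m → N ℕ.≤ n → ∣ x m ℚ.- x n ∣ ℚ.≤ ε

record ℝ : Set where
  constructor mkℝ
  field
    seq    : ℕ → ℚ
    cauchy : IsCauchy seq

open ℝ public

infix 4 _≤_ _<_ _≃_

_≤_ : ℝ → ℝ → Set
x ≤ y = ∀ ε → 0ℚ ℚ.< ε →
  ∃ λ N → ∀ n → N ℕ.≤ n → seq x n ℚ.≤ seq y n ℚ.+ ε

_<_ : ℝ → ℝ → Set
x < y = ∃ λ ε → 0ℚ ℚ.< ε ×
  ∃ λ N → ∀ n → N ℕ.≤ n → seq x n ℚ.+ ε ℚ.≤ seq y n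

_≃_ : ℝ → ℝ → Set
x ≃ y = x ≤ y × y ≤ x

p≤q+∣p-q∣ : ∀ p q → p ℚ.≤ q ℚ.+ ∣ p ℚ.- q ∣
p≤q+∣p-q∣ p q = begin
  p                     ≡⟨ solve 2 (λ p q → p := q :+ (p :- q)) refl p q ⟩
  q ℚ.+ (p ℚ.- q)       ≤⟨ ℚ.+-monoʳ-≤ q (p≤∣p∣ (p ℚ.- q)) ⟩
  q ℚ.+ ∣ p ℚ.- q ∣     ∎
  where
  open ℚ.≤-Reasoning
  open +-*-Solver
  p≤∣p∣ : ∀ p → p ℚ.≤ ∣ p ∣
  p≤∣p∣ p with ℚ.≤-total 0ℚ p
  ... | inj₁ 0≤p = ℚ.≤-reflexive (sym (ℚ.0≤p⇒∣p∣≡p 0≤p))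
  ... | inj₂ p≤0 = ℚ.≤-trans p≤0 (ℚ.0≤∣p∣ p)

∣p-q∣-sym : ∀ p q → ∣ p ℚ.- q ∣ ≡ ∣ q ℚ.- p ∣
∣p-q∣-sym p q = trans (sym (ℚ.∣-p∣≡∣p∣ (p ℚ.- q)))
  (cong ∣_∣ (solve 2 (λ p q → :- (p :- q) := q :- p) refl p q))
  where open +-*-Solver

∣p-q∣≤ : ∀ {p q e} → p ℚ.≤ q ℚ.+ e → q ℚ.≤ p ℚ.+ e → ∣ p ℚ.- q ∣ ℚ.≤ e
∣p-q∣≤ {p} {q} {e} p≤q+e q≤p+e with ℚ.∣p∣≡p∨∣p∣≡-p (p ℚ.- q)
... | inj₁ eq = begin
  ∣ p ℚ.- q ∣           ≡⟨ eq ⟩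
  p ℚ.- q               ≤⟨ ℚ.+-monoˡ-≤ (ℚ.- q) p≤q+e ⟩
  q ℚ.+ e ℚ.- q         ≡⟨ solve 2 (λ q e → q :+ e :- q := e) refl q e ⟩
  e                     ∎
  where
  open ℚ.≤-Reasoning
  open +-*-Solver
... | inj₂ eq = begin
  ∣ p ℚ.- q ∣           ≡⟨ eq ⟩
  ℚ.- (p ℚ.- q)         ≡⟨ solve 2 (λ p q → :- (p :- q) := q :- p) refl p q ⟩
  q ℚ.- p               ≤⟨ ℚ.+-monoˡ-≤ (ℚ.- p) q≤p+e ⟩
  p ℚ.+ e ℚ.- p         ≡⟨ solve 2 (λ p e → p :+ e :- p := e) refl p e ⟩
  e                     ∎
  where
  open ℚ.≤-Reasoning
  open +-*-Solver

0<p*q : ∀ {p q} → 0ℚ ℚ.< p → 0ℚ ℚ.< q → 0ℚ ℚ.< p ℚ.* q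
0<p*q {p} {q} 0<p 0<q =
  ℚ.positive⁻¹ (p ℚ.* q) {{ℚ.pos*pos⇒pos p {{ℚ.positive 0<p}} q {{ℚ.positive 0<q}}}}

0<½p : ∀ {p} → 0ℚ ℚ.< p → 0ℚ ℚ.< ½ ℚ.* p
0<½p = 0<p*q (ℚ.positive⁻¹ ½)

½p+½p : ∀ p → ½ ℚ.* p ℚ.+ ½ ℚ.* p ≡ p
½p+½p p = trans (sym (ℚ.*-distribʳ-+ p ½ ½)) (ℚ.*-identityˡ p)

*-mono-≤ : ∀ {p q r s} → 0ℚ ℚ.≤ r → 0ℚ ℚ.≤ q → p ℚ.≤ q → r ℚ.≤ s →
           p ℚ.* r ℚ.≤ q ℚ.* s
*-mono-≤ {p} {q} {r} {s} 0≤r 0≤q p≤q r≤s = ℚ.≤-trans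
  (ℚ.*-monoʳ-≤-nonNeg r {{ℚ.nonNegative 0≤r}} p≤q)
  (ℚ.*-monoˡ-≤-nonNeg q {{ℚ.nonNegative 0≤q}} r≤s)

p*[1/p*q] : ∀ p .{{_ : ℚ.NonZero p}} q → p ℚ.* ((ℚ.1/ p) ℚ.* q) ≡ q
p*[1/p*q] p q = trans (sym (ℚ.*-assoc p (ℚ.1/ p) q))
  (trans (cong (ℚ._* q) (ℚ.*-inverseʳ p)) (ℚ.*-identityˡ q))

NonExpansive : (ℚ → ℚ → ℚ) → Set
NonExpansive f = ∀ a b c d →
  ∣ f a b ℚ.- f c d ∣ ℚ.≤ ∣ a ℚ.- c ∣ ℚ.+ ∣ b ℚ.- d ∣

lift₂ : ∀ f → NonExpansive f → ℝ → ℝ → ℝ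
lift₂ f ne x y .seq n = f (seq x n) (seq y n)
lift₂ f ne x y .cauchy ε 0<ε
  with cauchy x (½ ℚ.* ε) (0<½p 0<ε) | cauchy y (½ ℚ.* ε) (0<½p 0<ε)
... | N , hx | M , hy = N ℕ.⊔ M , λ m n p q → ℚ.≤-trans
  (ne (seq x m) (seq y m) (seq x n) (seq y n))
  (ℚ.≤-trans
    (ℚ.+-mono-≤
      (hx m n (ℕ.m⊔n≤o⇒m≤o N M p) (ℕ.m⊔n≤o⇒m≤o N M q))
      (hy m n (ℕ.m⊔n≤o⇒n≤o N M p) (ℕ.m⊔n≤o⇒n≤o N M q)))
    (ℚ.≤-reflexive (½p+½p ε)))

+-nonExpansive : NonExpansive ℚ._+_
+-nonExpansive a b c d = ℚ.≤-trans
  (ℚ.≤-reflexive (cong ∣_∣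
    (solve 4 (λ a b c d → (a :+ b) :- (c :+ d) := (a :- c) :+ (b :- d)) refl a b c d)))
  (ℚ.∣p+q∣≤∣p∣+∣q∣ (a ℚ.- c) (b ℚ.- d))
  where open +-*-Solver

module _ (a b c d : ℚ) where

  a≤c+Δ : a ℚ.≤ c ℚ.+ (∣ a ℚ.- c ∣ ℚ.+ ∣ b ℚ.- d ∣)
  a≤c+Δ = ℚ.≤-trans (p≤q+∣p-q∣ a c) (ℚ.+-monoʳ-≤ c
    (ℚ.≤-trans (ℚ.≤-reflexive (sym (ℚ.+-identityʳ _)))
      (ℚ.+-monoʳ-≤ ∣ a ℚ.- c ∣ (ℚ.0≤∣p∣ (b ℚ.- d)))))

  b≤d+Δ : b ℚ.≤ d ℚ.+ (∣ a ℚ.- c ∣ ℚ.+ ∣ b ℚ.- d ∣)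
  b≤d+Δ = ℚ.≤-trans (p≤q+∣p-q∣ b d) (ℚ.+-monoʳ-≤ d
    (ℚ.≤-trans (ℚ.≤-reflexive (sym (ℚ.+-identityˡ _)))
      (ℚ.+-monoˡ-≤ ∣ b ℚ.- d ∣ (ℚ.0≤∣p∣ (a ℚ.- c)))))

  a⊔b≤c⊔d+Δ : a ℚ.⊔ b ℚ.≤ (c ℚ.⊔ d) ℚ.+ (∣ a ℚ.- c ∣ ℚ.+ ∣ b ℚ.- d ∣)
  a⊔b≤c⊔d+Δ = ℚ.⊔-lub
    (ℚ.≤-trans a≤c+Δ (ℚ.+-monoˡ-≤ _ (ℚ.p≤p⊔q c d)))
    (ℚ.≤-trans b≤d+Δ (ℚ.+-monoˡ-≤ _ (ℚ.p≤q⊔p c d)))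

  a⊓b≤c⊓d+Δ : a ℚ.⊓ b ℚ.≤ (c ℚ.⊓ d) ℚ.+ (∣ a ℚ.- c ∣ ℚ.+ ∣ b ℚ.- d ∣)
  a⊓b≤c⊓d+Δ with ℚ.⊓-sel c d
  ... | inj₁ eq rewrite eq = ℚ.≤-trans (ℚ.p⊓q≤p a b) a≤c+Δ
  ... | inj₂ eq rewrite eq = ℚ.≤-trans (ℚ.p⊓q≤q a b) b≤d+Δ

⊔-nonExpansive : NonExpansive ℚ._⊔_
⊔-nonExpansive a b c d = ∣p-q∣≤ (a⊔b≤c⊔d+Δ a b c d)
  (subst₂ (λ s t → c ℚ.⊔ d ℚ.≤ (a ℚ.⊔ b) ℚ.+ (s ℚ.+ t))
    (∣p-q∣-sym c a) (∣p-q∣-sym d b) (a⊔b≤c⊔d+Δ c d a b))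

⊓-nonExpansive : NonExpansive ℚ._⊓_
⊓-nonExpansive a b c d = ∣p-q∣≤ (a⊓b≤c⊓d+Δ a b c d)
  (subst₂ (λ s t → c ℚ.⊓ d ℚ.≤ (a ℚ.⊓ b) ℚ.+ (s ℚ.+ t))
    (∣p-q∣-sym c a) (∣p-q∣-sym d b) (a⊓b≤c⊓d+Δ c d a b))

∣ab-cd∣≤ : ∀ a b c d → ∣ a ℚ.* b ℚ.- c ℚ.* d ∣ ℚ.≤
           ∣ a ∣ ℚ.* ∣ b ℚ.- d ∣ ℚ.+ ∣ d ∣ ℚ.* ∣ a ℚ.- c ∣
∣ab-cd∣≤ a b c d = begin
  ∣ a ℚ.* b ℚ.- c ℚ.* d ∣
    ≡⟨ cong ∣_∣ (solve 4 (λ a b c d → a :* b :- c :* d := a :* (b :- d) :+ d :* (a :- c))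
         refl a b c d) ⟩
  ∣ a ℚ.* (b ℚ.- d) ℚ.+ d ℚ.* (a ℚ.- c) ∣
    ≤⟨ ℚ.∣p+q∣≤∣p∣+∣q∣ (a ℚ.* (b ℚ.- d)) _ ⟩
  ∣ a ℚ.* (b ℚ.- d) ∣ ℚ.+ ∣ d ℚ.* (a ℚ.- c) ∣
    ≡⟨ cong₂ ℚ._+_ (ℚ.∣p*q∣≡∣p∣*∣q∣ a (b ℚ.- d)) (ℚ.∣p*q∣≡∣p∣*∣q∣ d (a ℚ.- c)) ⟩
  ∣ a ∣ ℚ.* ∣ b ℚ.- d ∣ ℚ.+ ∣ d ∣ ℚ.* ∣ a ℚ.- c ∣ ∎
  where
  open ℚ.≤-Reasoning
  open +-*-Solver

∣u-v∣*ab : ∀ {a b u v} → 0ℚ ℚ.≤ a ℚ.* b → a ℚ.* u ≡ 1ℚ → b ℚ.* v ≡ 1ℚ →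
           ∣ u ℚ.- v ∣ ℚ.* (a ℚ.* b) ≡ ∣ b ℚ.- a ∣
∣u-v∣*ab {a} {b} {u} {v} 0≤ab au≡1 bv≡1 = begin
  ∣ u ℚ.- v ∣ ℚ.* (a ℚ.* b)
    ≡⟨ cong (∣ u ℚ.- v ∣ ℚ.*_) (sym (ℚ.0≤p⇒∣p∣≡p 0≤ab)) ⟩
  ∣ u ℚ.- v ∣ ℚ.* ∣ a ℚ.* b ∣
    ≡⟨ sym (ℚ.∣p*q∣≡∣p∣*∣q∣ (u ℚ.- v) (a ℚ.* b)) ⟩
  ∣ (u ℚ.- v) ℚ.* (a ℚ.* b) ∣
    ≡⟨ cong ∣_∣ (solve 4 (λ u v a b →
         (u :- v) :* (a :* b) := (a :* u) :* b :- (b :* v) :* a) refl u v a b) ⟩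
  ∣ (a ℚ.* u) ℚ.* b ℚ.- (b ℚ.* v) ℚ.* a ∣
    ≡⟨ cong₂ (λ s t → ∣ s ℚ.* b ℚ.- t ℚ.* a ∣) au≡1 bv≡1 ⟩
  ∣ 1ℚ ℚ.* b ℚ.- 1ℚ ℚ.* a ∣
    ≡⟨ cong₂ (λ s t → ∣ s ℚ.- t ∣) (ℚ.*-identityˡ b) (ℚ.*-identityˡ a) ⟩
  ∣ b ℚ.- a ∣ ∎
  where
  open ≡-Reasoning
  open +-*-Solver

bounded : ∀ x → ∃ λ B → 0ℚ ℚ.< B × ∃ λ N → ∀ n → N ℕ.≤ n → ∣ seq x n ∣ ℚ.≤ B
bounded x with cauchy x 1ℚ (ℚ.positive⁻¹ 1ℚ)
... | N , h = ∣ seq x N ∣ ℚ.+ 1ℚ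
  , ℚ.+-mono-≤-< (ℚ.0≤∣p∣ (seq x N)) (ℚ.positive⁻¹ 1ℚ)
  , N , λ n N≤n → begin
    ∣ seq x n ∣
      ≡⟨ cong ∣_∣ (solve 2 (λ p q → p := q :+ (p :- q)) refl (seq x n) (seq x N)) ⟩
    ∣ seq x N ℚ.+ (seq x n ℚ.- seq x N) ∣
      ≤⟨ ℚ.∣p+q∣≤∣p∣+∣q∣ (seq x N) _ ⟩
    ∣ seq x N ∣ ℚ.+ ∣ seq x n ℚ.- seq x N ∣
      ≤⟨ ℚ.+-monoʳ-≤ ∣ seq x N ∣ (h n N N≤n ℕ.≤-refl) ⟩
    ∣ seq x N ∣ ℚ.+ 1ℚ ∎
  where
  open ℚ.≤-Reasoning
  open +-*-Solver

fromℚ : ℚ → ℝ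
fromℚ q .seq _ = q
fromℚ q .cauchy ε 0<ε = 0 , λ _ _ _ _ →
  ℚ.≤-trans (ℚ.≤-reflexive (cong ∣_∣ (ℚ.+-inverseʳ q))) (ℚ.<⇒≤ 0<ε)

0ℝ : ℝ
0ℝ = fromℚ 0ℚ

infixl 7 _*_ _⊓_
infixl 6 _+_ _⊔_

_+_ _⊔_ _⊓_ : ℝ → ℝ → ℝ
_+_ = lift₂ ℚ._+_ +-nonExpansive
_⊔_ = lift₂ ℚ._⊔_ ⊔-nonExpansive
_⊓_ = lift₂ ℚ._⊓_ ⊓-nonExpansive

∣ab-cd∣≤ε : ∀ {a b c d A B δ η ε} → 0ℚ ℚ.≤ A → 0ℚ ℚ.≤ B →
  ∣ a ∣ ℚ.≤ A → ∣ d ∣ ℚ.≤ B → ∣ b ℚ.- d ∣ ℚ.≤ δ → ∣ a ℚ.- c ∣ ℚ.≤ η →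
  A ℚ.* δ ≡ ½ ℚ.* ε → B ℚ.* η ≡ ½ ℚ.* ε → ∣ a ℚ.* b ℚ.- c ℚ.* d ∣ ℚ.≤ ε
∣ab-cd∣≤ε {a} {b} {c} {d} {A} {B} {δ} {η} {ε} 0≤A 0≤B ∣a∣≤A ∣d∣≤B ∣b-d∣≤δ ∣a-c∣≤η Aδ≡ Bη≡ =
  begin
  ∣ a ℚ.* b ℚ.- c ℚ.* d ∣
    ≤⟨ ∣ab-cd∣≤ a b c d ⟩
  ∣ a ∣ ℚ.* ∣ b ℚ.- d ∣ ℚ.+ ∣ d ∣ ℚ.* ∣ a ℚ.- c ∣
    ≤⟨ ℚ.+-mono-≤
         (*-mono-≤ {∣ a ∣} {A} {∣ b ℚ.- d ∣} {δ} (ℚ.0≤∣p∣ (b ℚ.- d)) 0≤A ∣a∣≤A ∣b-d∣≤δ)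
         (*-mono-≤ {∣ d ∣} {B} {∣ a ℚ.- c ∣} {η} (ℚ.0≤∣p∣ (a ℚ.- c)) 0≤B ∣d∣≤B ∣a-c∣≤η) ⟩
  A ℚ.* δ ℚ.+ B ℚ.* η
    ≡⟨ cong₂ ℚ._+_ Aδ≡ Bη≡ ⟩
  ½ ℚ.* ε ℚ.+ ½ ℚ.* ε
    ≡⟨ ½p+½p ε ⟩
  ε ∎
  where open ℚ.≤-Reasoning

quotient : ∀ {p ε} → 0ℚ ℚ.< p → 0ℚ ℚ.< ε → ∃ λ δ → 0ℚ ℚ.< δ × p ℚ.* δ ≡ ε
quotient {p} {ε} 0<p 0<ε = (ℚ.1/ p) ℚ.* ε
  , 0<p*q {ℚ.1/ p} {ε} (ℚ.positive⁻¹ (ℚ.1/ p) {{ℚ.1/pos⇒pos p {{ℚ.positive 0<p}}}}) 0<ε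
  , p*[1/p*q] p ε
  where
  instance
    p≢0 : ℚ.NonZero p
    p≢0 = ℚ.pos⇒nonZero p {{ℚ.positive 0<p}}

_*_ : ℝ → ℝ → ℝ
(x * y) .seq n = seq x n ℚ.* seq y n
(x * y) .cauchy ε 0<ε =
  let A , 0<A , N₁ , ∣x∣≤A = bounded x
      B , 0<B , N₂ , ∣y∣≤B = bounded y
      δ , 0<δ , Aδ≡ = quotient 0<A (0<½p 0<ε)
      η , 0<η , Bη≡ = quotient 0<B (0<½p 0<ε)
      N₃ , hy = cauchy y δ 0<δ
      N₄ , hx = cauchy x η 0<η
      N = (N₁ ℕ.⊔ N₂) ℕ.⊔ (N₃ ℕ.⊔ N₄)
      l : ∀ {k} → N ℕ.≤ k → N₁ ℕ.⊔ N₂ ℕ.≤ k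
      l = ℕ.m⊔n≤o⇒m≤o (N₁ ℕ.⊔ N₂) (N₃ ℕ.⊔ N₄)
      r : ∀ {k} → N ℕ.≤ k → N₃ ℕ.⊔ N₄ ℕ.≤ k
      r = ℕ.m⊔n≤o⇒n≤o (N₁ ℕ.⊔ N₂) (N₃ ℕ.⊔ N₄)
  in N , λ m n p q → ∣ab-cd∣≤ε
      {seq x m} {seq y m} {seq x n} {seq y n} {A} {B} {δ} {η} {ε}
      (ℚ.<⇒≤ 0<A) (ℚ.<⇒≤ 0<B)
      (∣x∣≤A m (ℕ.m⊔n≤o⇒m≤o N₁ N₂ (l p)))
      (∣y∣≤B n (ℕ.m⊔n≤o⇒n≤o N₁ N₂ (l q)))
      (hy m n (ℕ.m⊔n≤o⇒m≤o N₃ N₄ (r p)) (ℕ.m⊔n≤o⇒m≤o N₃ N₄ (r q)))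
      (hx m n (ℕ.m⊔n≤o⇒n≤o N₃ N₄ (r p)) (ℕ.m⊔n≤o⇒n≤o N₃ N₄ (r q)))
      Aδ≡ Bη≡

0<p⊔ε : ∀ p {ε} → 0ℚ ℚ.< ε → 0ℚ ℚ.< p ℚ.⊔ ε
0<p⊔ε p {ε} 0<ε = ℚ.<-≤-trans 0<ε (ℚ.p≤q⊔p p ε)

p⊔ε≢0 : ∀ p {ε} → 0ℚ ℚ.< ε → ℚ.NonZero (p ℚ.⊔ ε)
p⊔ε≢0 p {ε} 0<ε = ℚ.pos⇒nonZero (p ℚ.⊔ ε) {{ℚ.positive (0<p⊔ε p 0<ε)}}

1/⊔ : ∀ p {ε} → 0ℚ ℚ.< ε → ℚ
1/⊔ p {ε} 0<ε = (ℚ.1/ (p ℚ.⊔ ε)) {{p⊔ε≢0 p 0<ε}}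

∣1/⊔-1/⊔∣≤ : ∀ p q {ε η} (0<ε : 0ℚ ℚ.< ε) → 0ℚ ℚ.< η →
  ∣ q ℚ.- p ∣ ℚ.≤ η ℚ.* (ε ℚ.* ε) → ∣ 1/⊔ p 0<ε ℚ.- 1/⊔ q 0<ε ∣ ℚ.≤ η
∣1/⊔-1/⊔∣≤ p q {ε} {η} 0<ε 0<η close = ℚ.*-cancelʳ-≤-pos (a ℚ.* b) {{ℚ.positive 0<ab}} (begin
  ∣ u ℚ.- v ∣ ℚ.* (a ℚ.* b)
    ≡⟨ ∣u-v∣*ab {a} {b} {u} {v} (ℚ.<⇒≤ 0<ab)
         (ℚ.*-inverseʳ a {{p⊔ε≢0 p 0<ε}}) (ℚ.*-inverseʳ b {{p⊔ε≢0 q 0<ε}}) ⟩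
  ∣ b ℚ.- a ∣
    ≤⟨ ⊔-nonExpansive q ε p ε ⟩
  ∣ q ℚ.- p ∣ ℚ.+ ∣ ε ℚ.- ε ∣
    ≡⟨ cong (λ z → ∣ q ℚ.- p ∣ ℚ.+ ∣ z ∣) (ℚ.+-inverseʳ ε) ⟩
  ∣ q ℚ.- p ∣ ℚ.+ 0ℚ
    ≡⟨ ℚ.+-identityʳ ∣ q ℚ.- p ∣ ⟩
  ∣ q ℚ.- p ∣
    ≤⟨ close ⟩
  η ℚ.* (ε ℚ.* ε)
    ≤⟨ ℚ.*-monoˡ-≤-nonNeg η {{ℚ.nonNegative (ℚ.<⇒≤ 0<η)}} {ε ℚ.* ε} {a ℚ.* b}
         (*-mono-≤ {ε} {a} {ε} {b} (ℚ.<⇒≤ 0<ε) (ℚ.<⇒≤ (0<p⊔ε p 0<ε))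
           (ℚ.p≤q⊔p p ε) (ℚ.p≤q⊔p q ε)) ⟩
  η ℚ.* (a ℚ.* b) ∎)
  where
  open ℚ.≤-Reasoning
  a = p ℚ.⊔ ε
  b = q ℚ.⊔ ε
  u = 1/⊔ p 0<ε
  v = 1/⊔ q 0<ε
  0<ab : 0ℚ ℚ.< a ℚ.* b
  0<ab = 0<p*q {a} {b} (0<p⊔ε p 0<ε) (0<p⊔ε q 0<ε)

-- A proof of 0ℝ < x provides ε with ε ≤ seq x n, and so seq x n ⊔ ε ≡ seq x n,
-- for all large n.  Truncating at ε makes every term invertible.
recip : ∀ x → 0ℝ < x → ℝ
recip x (ε , 0<ε , _) .seq n = 1/⊔ (seq x n) 0<ε
recip x (ε , 0<ε , _) .cauchy η 0<η =
  let N , h = cauchy x (η ℚ.* (ε ℚ.* ε)) (0<p*q 0<η (0<p*q 0<ε 0<ε))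
  in N , λ m n N≤m N≤n → ∣1/⊔-1/⊔∣≤ (seq x m) (seq x n) 0<ε 0<η (h n m N≤n N≤m)

infixl 7 _÷_⟨_⟩

_÷_⟨_⟩ : ℝ → ∀ y → 0ℝ < y → ℝ
x ÷ y ⟨ 0<y ⟩ = x * recip y 0<y

sum : ℕ → (ℕ → ℝ) → ℝ
sum zero    f = 0ℝ
sum (suc n) f = sum n f + f n

maximum : ∀ {m} → (Fin (suc m) → ℝ) → ℝ
maximum {zero}  f = f zero
maximum {suc m} f = f zero ⊔ maximum (λ i → f (suc i))

------------------------------------------------------------------------
-- Ordinal scheduling

record Realization : Set where
  field
    size          : (j : ℕ) .{{_ : NonZero j}} → ℝ
    nonincreasing : ∀ j .{{_ : NonZero j}} → size (suc j) ≤ size j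
    nonnegative   : ∀ j .{{_ : NonZero j}} → 0ℝ ≤ size j
    bound         : ℕ
    finite        : ∀ j .{{_ : NonZero j}} → bound ℕ.< j → size j ≃ 0ℝ

open Realization public

-- A partition of the positive integers into m (possibly empty) sets,
-- given by the map sending each job to the machine it is assigned to.
Solution : ℕ → Set
Solution m = (j : ℕ) .{{_ : NonZero j}} → Fin m

-- Jobs beyond the bound of the realization have size zero and are left out.
load : ∀ {m} → Solution m → Realization → Fin m → ℝ
load s p i = sum (bound p) λ k →
  if does (s (suc k) ≟ i) then size p (suc k) else 0ℝ

completionTime : ∀ {m} → Solution (suc m) → Realization → ℝ
completionTime s p = maximum (load s p)

-- λ* is the least completion time of p on suc m machines.  The double negation makes
-- attainment of the minimum classical: exhibiting an optimal solution would require
-- deciding the order of reals.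
IsOptimalCompletionTime : ℕ → Realization → ℝ → Set
IsOptimalCompletionTime m p λ* =
  (∀ (s : Solution (suc m)) → λ* ≤ completionTime s p) ×
  ¬ ¬ (∃ λ (s : Solution (suc m)) → completionTime s p ≃ λ*)

TwoSolutionAlgorithm : ℕ → Set
TwoSolutionAlgorithm m = Solution m × Solution m

makespan : ∀ {m} → TwoSolutionAlgorithm (suc m) → Realization → ℝ
makespan (s₁ , s₂) p = completionTime s₁ p ⊓ completionTime s₂ p

-- The supremum of the ratios, possibly infinite, is at most c exactly when c is
-- an upper bound of all of them.
CompetitiveRatioAtMost : ∀ {m} → TwoSolutionAlgorithm (suc m) → ℝ → Set
CompetitiveRatioAtMost {m} A c =
  ∀ p λ* → IsOptimalCompletionTime m p λ* →
  (0<λ* : 0ℝ < λ*) → makespan A p ÷ λ* ⟨ 0<λ* ⟩ ≤ c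

------------------------------------------------------------------------
-- The algorithm; machines 1, 2, 3, 4 are 0F, 1F, 2F, 3F

machine₁ : ℕ → Fin 4
machine₁ 1 = 0F
machine₁ 2 = 1F
machine₁ 3 = 2F
machine₁ 6 = 2F
machine₁ 0 = 2F
machine₁ _ = 3F

solution₁ : Solution 4
solution₁ j = machine₁ (j % 8)

machine₂ : ℕ → Fin 4
machine₂ 0 = 0F
machine₂ 3 = 1F
machine₂ 2 = 2F
machine₂ _ = 3F

solution₂ : Solution 4
solution₂ 1 = 0F
solution₂ 2 = 1F
solution₂ 3 = 2F
solution₂ 4 = 3F
solution₂ j = machine₂ (j % 4)

-- The job sets of the two solutions; solution₁-sets and solution₂-sets below show
-- that these are the sets given by solution₁ and solution₂.
jobs₁ jobs₂ : Fin 4 → ℕ → Set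
jobs₁ 0F j = ∃ λ k → j ≡ 8 ℕ.* k ℕ.+ 1
jobs₁ 1F j = ∃ λ k → j ≡ 8 ℕ.* k ℕ.+ 2
jobs₁ 2F j = (∃ λ k → j ≡ 8 ℕ.* k ℕ.+ 3) ⊎ (∃ λ k → j ≡ 8 ℕ.* k ℕ.+ 6)
           ⊎ (∃ λ k → 1 ℕ.≤ k × j ≡ 8 ℕ.* k)
jobs₁ 3F j = (∃ λ k → j ≡ 8 ℕ.* k ℕ.+ 4) ⊎ (∃ λ k → j ≡ 8 ℕ.* k ℕ.+ 5)
           ⊎ (∃ λ k → j ≡ 8 ℕ.* k ℕ.+ 7)
jobs₂ 0F j = j ≡ 1 ⊎ (∃ λ k → 2 ℕ.≤ k × j ≡ 4 ℕ.* k)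
jobs₂ 1F j = j ≡ 2 ⊎ (∃ λ k → 2 ℕ.≤ k × j ≡ 4 ℕ.* k ℕ.∸ 1)
jobs₂ 2F j = j ≡ 3 ⊎ (∃ λ k → 2 ℕ.≤ k × j ≡ 4 ℕ.* k ℕ.∸ 2)
jobs₂ 3F j = j ≡ 4 ⊎ (∃ λ k → 2 ℕ.≤ k × j ≡ 4 ℕ.* k ℕ.∸ 3)

solution₁-sets : ∀ j .{{_ : NonZero j}} i → solution₁ j ≡ i ⇔ jobs₁ i j
solution₁-sets j {{j≢0}} i = mk⇔ (to i) (from i)
  where
  eq : j ≡ 8 ℕ.* (j / 8) ℕ.+ j % 8
  eq = trans (m≡m%n+[m/n]*n j 8)
    (trans (ℕ.+-comm (j % 8) (j / 8 ℕ.* 8)) (cong (ℕ._+ j % 8) (ℕ.*-comm (j / 8) 8)))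

  residue : ∀ r k → j ≡ 8 ℕ.* k ℕ.+ r → j % 8 ≡ r % 8
  residue r k refl = trans
    (cong (_% 8) (trans (ℕ.+-comm (8 ℕ.* k) r) (cong (r ℕ.+_) (ℕ.*-comm 8 k))))
    ([m+kn]%n≡m%n r k 8)

  classify : ∀ r k → .(NonZero (8 ℕ.* k ℕ.+ r)) → r ℕ.< 8 →
             j ≡ 8 ℕ.* k ℕ.+ r → jobs₁ (machine₁ r) j
  classify 0 zero () _ _
  classify 0 (suc k) _ _ e = inj₂ (inj₂ (suc k , ℕ.s≤s ℕ.z≤n , trans e (ℕ.+-identityʳ _)))
  classify 1 k _ _ e = k , e
  classify 2 k _ _ e = k , e
  classify 3 k _ _ e = inj₁ (k , e)
  classify 4 k _ _ e = inj₁ (k , e)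
  classify 5 k _ _ e = inj₂ (inj₁ (k , e))
  classify 6 k _ _ e = inj₂ (inj₁ (k , e))
  classify 7 k _ _ e = inj₂ (inj₂ (k , e))
  classify (suc (suc (suc (suc (suc (suc (suc (suc r)))))))) k _ r<8 e =
    contradiction r<8 (ℕ.m+n≮m 8 r)

  to : ∀ i → solution₁ j ≡ i → jobs₁ i j
  to _ refl = classify (j % 8) (j / 8) (subst NonZero eq j≢0) (m%n<n j 8) eq

  from : ∀ i → jobs₁ i j → solution₁ j ≡ i
  from 0F (k , e) = cong machine₁ (residue 1 k e)
  from 1F (k , e) = cong machine₁ (residue 2 k e)
  from 2F (inj₁ (k , e)) = cong machine₁ (residue 3 k e)
  from 2F (inj₂ (inj₁ (k , e))) = cong machine₁ (residue 6 k e)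
  from 2F (inj₂ (inj₂ (k , _ , e))) =
    cong machine₁ (residue 0 k (trans e (sym (ℕ.+-identityʳ _))))
  from 3F (inj₁ (k , e)) = cong machine₁ (residue 4 k e)
  from 3F (inj₂ (inj₁ (k , e))) = cong machine₁ (residue 5 k e)
  from 3F (inj₂ (inj₂ (k , e))) = cong machine₁ (residue 7 k e)

solution₂-sets : ∀ j .{{_ : NonZero j}} i → solution₂ j ≡ i ⇔ jobs₂ i j
solution₂-sets j i = mk⇔ (λ e → subst (λ i → jobs₂ i j) e (to j)) (from j i)
  where
  4*[2+k] : ∀ k → 4 ℕ.* (2 ℕ.+ k) ≡ 8 ℕ.+ k ℕ.* 4
  4*[2+k] k = ℕ.*-comm 4 (2 ℕ.+ k)

  value : ∀ r k → solution₂ (5 ℕ.+ (r ℕ.+ k ℕ.* 4)) ≡ machine₂ ((5 ℕ.+ r) % 4)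
  value r k = cong machine₂ ([m+kn]%n≡m%n (5 ℕ.+ r) k 4)

  from₅ : ∀ j .{{_ : NonZero j}} r k → j ≡ 5 ℕ.+ (r ℕ.+ k ℕ.* 4) →
          solution₂ j ≡ machine₂ ((5 ℕ.+ r) % 4)
  from₅ _ r k refl = value r k

  to₅ : ∀ r k → r ℕ.< 4 → jobs₂ (machine₂ ((5 ℕ.+ r) % 4)) (5 ℕ.+ (r ℕ.+ k ℕ.* 4))
  to₅ 0 k _ = inj₂ (2 ℕ.+ k , ℕ.m≤m+n 2 k , sym (cong (ℕ._∸ 3) (4*[2+k] k)))
  to₅ 1 k _ = inj₂ (2 ℕ.+ k , ℕ.m≤m+n 2 k , sym (cong (ℕ._∸ 2) (4*[2+k] k)))
  to₅ 2 k _ = inj₂ (2 ℕ.+ k , ℕ.m≤m+n 2 k , sym (cong (ℕ._∸ 1) (4*[2+k] k)))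
  to₅ 3 k _ = inj₂ (2 ℕ.+ k , ℕ.m≤m+n 2 k , sym (4*[2+k] k))
  to₅ (suc (suc (suc (suc r)))) k r<4 = contradiction r<4 (ℕ.m+n≮m 4 r)

  to : ∀ j .{{_ : NonZero j}} → jobs₂ (solution₂ j) j
  to 1 = inj₁ refl
  to 2 = inj₁ refl
  to 3 = inj₁ refl
  to 4 = inj₁ refl
  to (suc (suc (suc (suc (suc n))))) =
    subst (λ n → jobs₂ (solution₂ (5 ℕ.+ n)) (5 ℕ.+ n)) (sym (m≡m%n+[m/n]*n n 4))
      (subst (λ i → jobs₂ i (5 ℕ.+ (n % 4 ℕ.+ n / 4 ℕ.* 4))) (sym (value (n % 4) (n / 4)))
        (to₅ (n % 4) (n / 4) (m%n<n n 4)))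

  from : ∀ j .{{_ : NonZero j}} i → jobs₂ i j → solution₂ j ≡ i
  from _ 0F (inj₁ refl) = refl
  from _ 1F (inj₁ refl) = refl
  from _ 2F (inj₁ refl) = refl
  from _ 3F (inj₁ refl) = refl
  from j 0F (inj₂ (suc (suc k) , _ , e)) = from₅ j 3 k (trans e (4*[2+k] k))
  from j 1F (inj₂ (suc (suc k) , _ , e)) = from₅ j 2 k (trans e (cong (ℕ._∸ 1) (4*[2+k] k)))
  from j 2F (inj₂ (suc (suc k) , _ , e)) = from₅ j 1 k (trans e (cong (ℕ._∸ 2) (4*[2+k] k)))
  from j 3F (inj₂ (suc (suc k) , _ , e)) = from₅ j 0 k (trans e (cong (ℕ._∸ 3) (4*[2+k] k)))
  from _ 0F (inj₂ (1 , ℕ.s≤s () , _))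
  from _ 1F (inj₂ (1 , ℕ.s≤s () , _))
  from _ 2F (inj₂ (1 , ℕ.s≤s () , _))
  from _ 3F (inj₂ (1 , ℕ.s≤s () , _))

algorithm : TwoSolutionAlgorithm 4
algorithm = solution₁ , solution₂

{-# OPTIONS --safe #-}
module Submission where

open import Data.Integer using (+_)
open import Data.Rational using (_/_)
open import Defs

open import Algebra.Bundles using (CommutativeRing)
open import Data.Bool using (if_then_else_; true; false)
open import Data.Fin using (Fin; zero; suc; toℕ; _≟_)
open import Data.Fin.Patterns using (0F; 1F; 2F; 3F)
import Data.Fin.Properties as Fin
open import Data.Nat as ℕ using (ℕ; zero; suc)
open import Data.Nat.Induction using (<-rec)
import Data.Nat.Properties as ℕ
open import Data.Nat.Solver using () renaming (module +-*-Solver to ℕ-Solver)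
open import Data.Product using (∃; _×_; _,_; proj₁; proj₂)
open import Data.Rational as ℚ using (ℚ; 0ℚ; 1ℚ; ½)
import Data.Rational.Properties as ℚ
open import Data.Rational.Solver using (module +-*-Solver)
open import Data.Sum using (_⊎_; inj₁; inj₂; [_,_]′)
open import Function using (_∘_)
open import Relation.Binary.PropositionalEquality
  using (_≡_; refl; sym; trans; cong; cong₂; subst; subst₂; module ≡-Reasoning)
open import Relation.Nullary using (¬_; Dec; does; yes; no; contradiction)
open import Relation.Nullary.Decidable using (True; toWitness; decidable-stable; _×-dec_)
open import Algebra.Properties.Semiring.Mult (CommutativeRing.semiring ℚ.+-*-commutativeRing)
  using (×-homo-+; ×1-homo-*) renaming (_×_ to _⨯_)

-- Let L be the optimum, S the sum of all sizes, and Mᵢ, Mᵢ′ the loads of machine i in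
-- the first and the second solution.  Then S ≤ 4L, p₁ ≤ L and p₄ + p₅ ≤ L.  For
-- nonincreasing sizes, comparing prefix sums of coefficients (Abel summation) gives
--   8M₁, 8M₂ ≤ S + 7p₁,   8M₃′ ≤ 2S + 2p₁ + (p₄ + p₅),   8M₄′ ≤ 2S + 3(p₄ + p₅),
-- each at most 11L, and, for i = 3 and 4,
--   M₁′ + 2Mᵢ ≤ S,   2M₂′ + Mᵢ ≤ S.
-- So if M₃ or M₄ exceeds 11L/8, then M₁′ and M₂′ are at most 11L/8, and the second
-- solution is good; otherwise the first one is.
--
-- The rational approximations of the sizes need not be monotone, so the sizes are first
-- replaced by equal reals (their suffix maxima) whose approximations are.

-- Prefix sums of eventually periodic weights

-- A weight w assigns the coefficient w k to job k + 1.

prefix : (ℕ → ℕ) → ℕ → ℕ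
prefix w zero    = 0
prefix w (suc n) = prefix w n ℕ.+ w n

infix 4 _≼_

_≼_ : (ℕ → ℕ) → (ℕ → ℕ) → Set
w ≼ v = ∀ n → prefix w n ℕ.≤ prefix v n

-- The solutions have period 8 from job 9 on.
Periodic : (ℕ → ℕ) → Set
Periodic w = ∀ k → w (16 ℕ.+ k) ≡ w (8 ℕ.+ k)

-- From job 9 on, any eight consecutive jobs carry the same total weight, `prefix w 16` minus
-- `prefix w 8`. Both sides are rearranged so that no truncated subtraction occurs.
prefix-periodic : ∀ {w} → Periodic w → ∀ n →
  prefix w (16 ℕ.+ n) ℕ.+ prefix w 8 ≡ prefix w (8 ℕ.+ n) ℕ.+ prefix w 16
prefix-periodic {w} per zero = ℕ.+-comm (prefix w 16) (prefix w 8)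
prefix-periodic {w} per (suc n) = begin
  prefix w (16 ℕ.+ n) ℕ.+ w (16 ℕ.+ n) ℕ.+ prefix w 8
    ≡⟨ swap (prefix w (16 ℕ.+ n)) (w (16 ℕ.+ n)) (prefix w 8) ⟩
  prefix w (16 ℕ.+ n) ℕ.+ prefix w 8 ℕ.+ w (16 ℕ.+ n)
    ≡⟨ cong₂ ℕ._+_ (prefix-periodic per n) (per n) ⟩
  prefix w (8 ℕ.+ n) ℕ.+ prefix w 16 ℕ.+ w (8 ℕ.+ n)
    ≡⟨ swap (prefix w (8 ℕ.+ n)) (prefix w 16) (w (8 ℕ.+ n)) ⟩
  prefix w (8 ℕ.+ n) ℕ.+ w (8 ℕ.+ n) ℕ.+ prefix w 16 ∎
  where
  open ≡-Reasoning
  open ℕ-Solver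
  swap : ∀ a b c → a ℕ.+ b ℕ.+ c ≡ a ℕ.+ c ℕ.+ b
  swap = solve 3 (λ a b c → a :+ b :+ c := a :+ c :+ b) refl

-- The equations say that `a′` exceeds `a` by `a₁ - a₀` and `b′` exceeds `b` by `b₁ - b₀`; the last
-- hypothesis compares these two excesses.
excess-≤ : ∀ {a a′ a₀ a₁ b b′ b₀ b₁} → a′ ℕ.+ a₀ ≡ a ℕ.+ a₁ → b′ ℕ.+ b₀ ≡ b ℕ.+ b₁ →
  a ℕ.≤ b → a₁ ℕ.+ b₀ ℕ.≤ b₁ ℕ.+ a₀ → a′ ℕ.≤ b′
excess-≤ {a} {a′} {a₀} {a₁} {b} {b′} {b₀} {b₁} p q a≤b h = ℕ.+-cancelʳ-≤ (a₀ ℕ.+ b₀) a′ b′ (begin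
  a′ ℕ.+ (a₀ ℕ.+ b₀)   ≡⟨ ℕ.+-assoc a′ a₀ b₀ ⟨
  a′ ℕ.+ a₀ ℕ.+ b₀     ≡⟨ cong (ℕ._+ b₀) p ⟩
  a ℕ.+ a₁ ℕ.+ b₀      ≡⟨ ℕ.+-assoc a a₁ b₀ ⟩
  a ℕ.+ (a₁ ℕ.+ b₀)    ≤⟨ ℕ.+-mono-≤ a≤b h ⟩
  b ℕ.+ (b₁ ℕ.+ a₀)    ≡⟨ ℕ.+-assoc b b₁ a₀ ⟨
  b ℕ.+ b₁ ℕ.+ a₀      ≡⟨ cong (ℕ._+ a₀) q ⟨
  b′ ℕ.+ b₀ ℕ.+ a₀     ≡⟨ ℕ.+-assoc b′ b₀ a₀ ⟩
  b′ ℕ.+ (b₀ ℕ.+ a₀)   ≡⟨ cong (b′ ℕ.+_) (ℕ.+-comm b₀ a₀) ⟩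
  b′ ℕ.+ (a₀ ℕ.+ b₀)   ∎)
  where open ℕ.≤-Reasoning

-- The second component compares the total weights of jobs 9 to 16, one full period, again without
-- subtraction.
PeriodCheck : (w v : ℕ → ℕ) → Set
PeriodCheck w v = (∀ {n} → n ℕ.< 16 → prefix w n ℕ.≤ prefix v n)
                × prefix w 16 ℕ.+ prefix v 8 ℕ.≤ prefix v 16 ℕ.+ prefix w 8

periodCheck? : ∀ w v → Dec (PeriodCheck w v)
periodCheck? w v = ℕ.allUpTo? (λ n → prefix w n ℕ.≤? prefix v n) 16
  ×-dec (prefix w 16 ℕ.+ prefix v 8 ℕ.≤? prefix v 16 ℕ.+ prefix w 8)

-- Induction in steps of 8: past job 8 both prefix sums grow by a fixed amount per period, and that
-- of `w` is no larger. The values below 16 are the base cases. Evaluating `periodCheck?` fills the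
-- implicit argument.
≼-periodic : ∀ {w v} → Periodic w → Periodic v → {True (periodCheck? w v)} → w ≼ v
≼-periodic {w} {v} per-w per-v {checked} = <-rec P step
  where
  P : ℕ → Set
  P n = prefix w n ℕ.≤ prefix v n

  shift : ∀ m → P (8 ℕ.+ m) → P (16 ℕ.+ m)
  shift m h = excess-≤ (prefix-periodic per-w m) (prefix-periodic per-v m)
    h (proj₂ (toWitness checked))

  step : ∀ n → (∀ {m} → m ℕ.< n → P m) → P n
  step n rec with ℕ.<-≤-connex n 16
  ... | inj₁ n<16 = proj₁ (toWitness checked) n<16
  ... | inj₂ 16≤n = subst P eq (shift (n ℕ.∸ 16)
    (rec (subst (8 ℕ.+ (n ℕ.∸ 16) ℕ.<_) eq (ℕ.m<n+m (8 ℕ.+ (n ℕ.∸ 16)) {8} ℕ.z<s))))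
    where
    eq : 16 ℕ.+ (n ℕ.∸ 16) ≡ n
    eq = ℕ.m+[n∸m]≡n 16≤n

-- Weights of the machines and their comparisons

share : ∀ {m} → Solution m → Fin m → ℕ → ℕ
share s i k = if does (s (suc k) ≟ i) then 1 else 0

all δ₁ δ₄₅ : ℕ → ℕ
all _ = 1
δ₁ 0 = 1
δ₁ _ = 0
δ₄₅ 3 = 1
δ₄₅ 4 = 1
δ₄₅ _ = 0

-- In load names such as 3₂, machine 3 of solution 2 is meant.
bound-1₁ : (λ k → 8 ℕ.* share solution₁ 0F k) ≼ (λ k → all k ℕ.+ 7 ℕ.* δ₁ k)
bound-1₁ = ≼-periodic (λ _ → refl) (λ _ → refl)

bound-2₁ : (λ k → 8 ℕ.* share solution₁ 1F k) ≼ (λ k → all k ℕ.+ 7 ℕ.* δ₁ k)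
bound-2₁ = ≼-periodic (λ _ → refl) (λ _ → refl)

-- The coefficients 2, 2 and 1 are chosen so that the prefix sums agree at every job of this
-- machine: 8 at job 3, 16 at job 6, 24 at job 10, then 8 more every four jobs.
bound-3₂ : (λ k → 8 ℕ.* share solution₂ 2F k) ≼ (λ k → 2 ℕ.* all k ℕ.+ (2 ℕ.* δ₁ k ℕ.+ δ₄₅ k))
bound-3₂ = ≼-periodic (λ _ → refl) (λ _ → refl)

bound-4₂ : (λ k → 8 ℕ.* share solution₂ 3F k) ≼ (λ k → 2 ℕ.* all k ℕ.+ 3 ℕ.* δ₄₅ k)
bound-4₂ = ≼-periodic (λ _ → refl) (λ _ → refl)

-- In each period from job 9 on, machines 1 and 2 of the second solution get two jobs each, machines
-- 3 and 4 of the first three each. So the left side gains 2 + 2 * 3 = 8 per period here and in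
-- `bound-1₂4₁`, and 2 * 2 + 3 = 7 in the two bounds after that.
bound-1₂3₁ : (λ k → share solution₂ 0F k ℕ.+ 2 ℕ.* share solution₁ 2F k) ≼ all
bound-1₂3₁ = ≼-periodic (λ _ → refl) (λ _ → refl)

bound-1₂4₁ : (λ k → share solution₂ 0F k ℕ.+ 2 ℕ.* share solution₁ 3F k) ≼ all
bound-1₂4₁ = ≼-periodic (λ _ → refl) (λ _ → refl)

bound-2₂3₁ : (λ k → 2 ℕ.* share solution₂ 1F k ℕ.+ share solution₁ 2F k) ≼ all
bound-2₂3₁ = ≼-periodic (λ _ → refl) (λ _ → refl)

bound-2₂4₁ : (λ k → 2 ℕ.* share solution₂ 1F k ℕ.+ share solution₁ 3F k) ≼ all
bound-2₂4₁ = ≼-periodic (λ _ → refl) (λ _ → refl)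

-- Weights dominated by the machines of an arbitrary solution

prefix-mono-≤ : ∀ w {m n} → m ℕ.≤ n → prefix w m ℕ.≤ prefix w n
prefix-mono-≤ w {m} {n} m≤n = subst (λ n → prefix w m ℕ.≤ prefix w n) (ℕ.m+[n∸m]≡n m≤n) (go (n ℕ.∸ m))
  where
  go : ∀ k → prefix w m ℕ.≤ prefix w (m ℕ.+ k)
  go zero    = ℕ.≤-reflexive (cong (prefix w) (sym (ℕ.+-identityʳ m)))
  go (suc k) = subst (λ n → prefix w m ℕ.≤ prefix w n) (sym (ℕ.+-suc m k))
    (ℕ.m≤n⇒m≤n+o (w (m ℕ.+ k)) (go k))

pointwise-≼ : ∀ {w v} → (∀ k → w k ℕ.≤ v k) → w ≼ v
pointwise-≼ w≤v zero    = ℕ.z≤n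
pointwise-≼ w≤v (suc n) = ℕ.+-mono-≤ (pointwise-≼ w≤v n) (w≤v n)

share-own : ∀ {m} (s : Solution m) k → share s (s (suc k)) k ≡ 1
share-own s k with s (suc k) ≟ s (suc k)
... | yes _ = refl
... | no ≢  = contradiction refl ≢

δ₁-≼ : ∀ {m} (s : Solution m) → δ₁ ≼ share s (s 1)
δ₁-≼ s = pointwise-≼ λ where
  zero    → ℕ.≤-reflexive (sym (share-own s 0))
  (suc _) → ℕ.z≤n

-- Two of the first five jobs share a machine. The earlier is at most job 4 and the later at most
-- job 5, so the prefix sums of that machine reach 1 and 2 no later than those of `δ₄₅`.
δ₄₅-≼ : (s : Solution 4) → ∃ λ i → δ₄₅ ≼ share s i
δ₄₅-≼ s with i , j , i<j , same ← Fin.pigeonhole (ℕ.≤-refl {5}) (λ (k : Fin 5) → s (suc (toℕ k))) =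
  s (suc (toℕ j)) , dominates
  where
  w : ℕ → ℕ
  w = share s (s (suc (toℕ j)))

  w-i : w (toℕ i) ≡ 1
  w-i = subst (λ o → share s o (toℕ i) ≡ 1) same (share-own s (toℕ i))

  1≤prefix : 1 ℕ.≤ prefix w (suc (toℕ i))
  1≤prefix = ℕ.m≤n⇒m≤o+n (prefix w (toℕ i)) (ℕ.≤-reflexive (sym w-i))

  2≤prefix : 2 ℕ.≤ prefix w (suc (toℕ j))
  2≤prefix = ℕ.+-mono-≤ (ℕ.≤-trans 1≤prefix (prefix-mono-≤ w i<j))
    (ℕ.≤-reflexive (sym (share-own s (toℕ j))))

  prefix-δ₄₅ : ∀ n → prefix δ₄₅ (5 ℕ.+ n) ≡ 2
  prefix-δ₄₅ zero    = refl
  prefix-δ₄₅ (suc n) = trans (ℕ.+-identityʳ _) (prefix-δ₄₅ n)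

  dominates : δ₄₅ ≼ w
  dominates 0 = ℕ.z≤n
  dominates 1 = ℕ.z≤n
  dominates 2 = ℕ.z≤n
  dominates 3 = ℕ.z≤n
  -- `toℕ i` is strictly below `toℕ j`, hence below 4, so the earlier job is among the first four.
  dominates 4 = ℕ.≤-trans 1≤prefix (prefix-mono-≤ w (ℕ.≤-trans i<j (ℕ.s≤s⁻¹ (Fin.toℕ<n j))))
  dominates (suc (suc (suc (suc (suc n))))) = subst (ℕ._≤ prefix w (5 ℕ.+ n)) (sym (prefix-δ₄₅ n))
    (ℕ.≤-trans 2≤prefix (prefix-mono-≤ w (ℕ.≤-trans (Fin.toℕ<n j) (ℕ.m≤m+n 5 n))))

shares : Solution 4 → ℕ → ℕ
shares s k = (share s 0F k ℕ.+ share s 1F k) ℕ.+ (share s 2F k ℕ.+ share s 3F k)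

all-≼ : ∀ s → all ≼ shares s
all-≼ s = pointwise-≼ λ k → ℕ.≤-reflexive (total (s (suc k)))
  where
  total : ∀ (i : Fin 4) → 1 ≡
    ((if does (i ≟ 0F) then 1 else 0) ℕ.+ (if does (i ≟ 1F) then 1 else 0)) ℕ.+
    ((if does (i ≟ 2F) then 1 else 0) ℕ.+ (if does (i ≟ 3F) then 1 else 0))
  total 0F = refl
  total 1F = refl
  total 2F = refl
  total 3F = refl

-- Weighted sums of rational sizes

∑ : ℕ → (ℕ → ℚ) → ℚ
∑ zero    f = 0ℚ
∑ (suc n) f = ∑ n f ℚ.+ f n

-- As a multiple of `1ℚ`, this inherits additivity and multiplicativity from the semiring laws of
-- multiples, while closed values such as `ι 8` still compute.
ι : ℕ → ℚ
ι n = n ⨯ 1ℚ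

ι-nonneg : ∀ n → 0ℚ ℚ.≤ ι n
ι-nonneg zero    = ℚ.≤-refl
ι-nonneg (suc n) = ℚ.+-mono-≤ (ℚ.nonNegative⁻¹ 1ℚ) (ι-nonneg n)

*-monoˡ-≤ : ∀ {p q r} → 0ℚ ℚ.≤ r → p ℚ.≤ q → r ℚ.* p ℚ.≤ r ℚ.* q
*-monoˡ-≤ {r = r} 0≤r = ℚ.*-monoˡ-≤-nonNeg r {{ℚ.nonNegative 0≤r}}

module Weighted (q : ℕ → ℚ) (n : ℕ) where

  ⟨_⟩ : (ℕ → ℕ) → ℚ
  ⟨ w ⟩ = ∑ n (λ k → ι (w k) ℚ.* q k)

  ⟨⟩-+ : ∀ w v → ⟨ (λ k → w k ℕ.+ v k) ⟩ ≡ ⟨ w ⟩ ℚ.+ ⟨ v ⟩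
  ⟨⟩-+ w v = go n
    where
    open +-*-Solver
    open ≡-Reasoning
    regroup : ∀ a b c d x → (a ℚ.+ b) ℚ.+ (c ℚ.+ d) ℚ.* x ≡ (a ℚ.+ c ℚ.* x) ℚ.+ (b ℚ.+ d ℚ.* x)
    regroup = solve 5 (λ a b c d x →
      (a :+ b) :+ (c :+ d) :* x := (a :+ c :* x) :+ (b :+ d :* x)) refl
    go : ∀ n → ∑ n (λ k → ι (w k ℕ.+ v k) ℚ.* q k)
             ≡ ∑ n (λ k → ι (w k) ℚ.* q k) ℚ.+ ∑ n (λ k → ι (v k) ℚ.* q k)
    go zero    = refl
    go (suc n) = trans
      (cong₂ (λ a b → a ℚ.+ b ℚ.* q n) (go n) (×-homo-+ 1ℚ (w n) (v n)))
      (regroup (∑ n (λ k → ι (w k) ℚ.* q k)) (∑ n (λ k → ι (v k) ℚ.* q k))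
        (ι (w n)) (ι (v n)) (q n))

  ⟨⟩-* : ∀ c w → ⟨ (λ k → c ℕ.* w k) ⟩ ≡ ι c ℚ.* ⟨ w ⟩
  ⟨⟩-* c w = go n
    where
    open +-*-Solver
    regroup : ∀ a b c x → c ℚ.* a ℚ.+ c ℚ.* b ℚ.* x ≡ c ℚ.* (a ℚ.+ b ℚ.* x)
    regroup = solve 4 (λ a b c x → c :* a :+ c :* b :* x := c :* (a :+ b :* x)) refl
    go : ∀ n → ∑ n (λ k → ι (c ℕ.* w k) ℚ.* q k) ≡ ι c ℚ.* ∑ n (λ k → ι (w k) ℚ.* q k)
    go zero    = sym (ℚ.*-zeroʳ (ι c))
    go (suc n) = trans
      (cong₂ (λ a b → a ℚ.+ b ℚ.* q n) (go n) (×1-homo-* c (w n)))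
      (regroup (∑ n (λ k → ι (w k) ℚ.* q k)) (ι (w n)) (ι c) (q n))

  module _ (nonincreasing : ∀ k → q (suc k) ℚ.≤ q k) (nonnegative : ∀ k → 0ℚ ℚ.≤ q k) where

    -- The gap between the two sums is a combination of the drops `q k - q (suc k)` and a last size,
    -- with differences of prefix sums as coefficients; all of these are nonnegative.
    ⟨⟩-mono : ∀ {w v} → w ≼ v → ⟨ w ⟩ ℚ.≤ ⟨ v ⟩
    ⟨⟩-mono {w} {v} w≼v = begin
      ∑ n wq                    ≡⟨ ℚ.+-identityʳ (∑ n wq) ⟨
      ∑ n wq ℚ.+ 0ℚ             ≤⟨ ℚ.+-monoʳ-≤ (∑ n wq) (ι*-nonneg e) ⟩
      ∑ n wq ℚ.+ ι e ℚ.* q n    ≤⟨ go n e (ℕ.m+[n∸m]≡n (w≼v n)) ⟩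
      ∑ n vq                    ∎
      where
      open ℚ.≤-Reasoning
      open +-*-Solver
      wq vq : ℕ → ℚ
      wq k = ι (w k) ℚ.* q k
      vq k = ι (v k) ℚ.* q k
      e : ℕ
      e = prefix v n ℕ.∸ prefix w n

      ι*-nonneg : ∀ e {k} → 0ℚ ℚ.≤ ι e ℚ.* q k
      ι*-nonneg e {k} = ℚ.≤-trans (ℚ.≤-reflexive (sym (ℚ.*-zeroʳ (ι e))))
        (*-monoˡ-≤ (ι-nonneg e) (nonnegative k))

      regroup : ∀ a b c x → a ℚ.+ b ℚ.* x ℚ.+ c ℚ.* x ≡ a ℚ.+ (b ℚ.+ c) ℚ.* x
      regroup = solve 4 (λ a b c x → a :+ b :* x :+ c :* x := a :+ (b :+ c) :* x) refl

      -- Abel summation, e being the slack of the prefix sums at n.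
      go : ∀ n e → prefix w n ℕ.+ e ≡ prefix v n → ∑ n wq ℚ.+ ι e ℚ.* q n ℚ.≤ ∑ n vq
      go zero    e refl = ℚ.≤-reflexive (trans (ℚ.+-identityˡ (0ℚ ℚ.* q 0)) (ℚ.*-zeroˡ (q 0)))
      go (suc n) e eq = begin
        ∑ n wq ℚ.+ ι (w n) ℚ.* q n ℚ.+ ι e ℚ.* q (suc n)
          ≤⟨ ℚ.+-monoʳ-≤ (∑ n wq ℚ.+ ι (w n) ℚ.* q n) (*-monoˡ-≤ (ι-nonneg e) (nonincreasing n)) ⟩
        ∑ n wq ℚ.+ ι (w n) ℚ.* q n ℚ.+ ι e ℚ.* q n
          ≡⟨ regroup (∑ n wq) (ι (w n)) (ι e) (q n) ⟩
        ∑ n wq ℚ.+ (ι (w n) ℚ.+ ι e) ℚ.* q n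
          ≡⟨ cong (λ c → ∑ n wq ℚ.+ c ℚ.* q n) slack ⟩
        ∑ n wq ℚ.+ (ι d ℚ.+ ι (v n)) ℚ.* q n
          ≡⟨ regroup (∑ n wq) (ι d) (ι (v n)) (q n) ⟨
        ∑ n wq ℚ.+ ι d ℚ.* q n ℚ.+ ι (v n) ℚ.* q n
          ≤⟨ ℚ.+-monoˡ-≤ (ι (v n) ℚ.* q n) (go n d (ℕ.m+[n∸m]≡n (w≼v n))) ⟩
        ∑ n vq ℚ.+ ι (v n) ℚ.* q n ∎
        where
        d : ℕ
        d = prefix v n ℕ.∸ prefix w n
        slackᴺ : w n ℕ.+ e ≡ d ℕ.+ v n
        slackᴺ = ℕ.+-cancelˡ-≡ (prefix w n) (w n ℕ.+ e) (d ℕ.+ v n)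
          (trans (sym (ℕ.+-assoc (prefix w n) (w n) e)) (trans eq
            (trans (cong (ℕ._+ v n) (sym (ℕ.m+[n∸m]≡n (w≼v n))))
              (ℕ.+-assoc (prefix w n) d (v n)))))
        slack : ι (w n) ℚ.+ ι e ≡ ι d ℚ.+ ι (v n)
        slack = trans (sym (×-homo-+ 1ℚ (w n) e))
          (trans (cong ι slackᴺ) (×-homo-+ 1ℚ d (v n)))

-- Arithmetic with the constant 11/8

0≤q-p : ∀ {p q} → p ℚ.≤ q → 0ℚ ℚ.≤ q ℚ.- p
0≤q-p {p} {q} p≤q = subst (ℚ._≤ q ℚ.- p) (ℚ.+-inverseʳ p) (ℚ.+-monoˡ-≤ (ℚ.- p) p≤q)

0≤q-p⇒p≤q : ∀ {p q} → 0ℚ ℚ.≤ q ℚ.- p → p ℚ.≤ q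
0≤q-p⇒p≤q {p} {q} h = subst₂ ℚ._≤_ (ℚ.+-identityˡ p) (cancel q p) (ℚ.+-monoˡ-≤ p h)
  where
  open +-*-Solver
  cancel : ∀ q p → q ℚ.- p ℚ.+ p ≡ q
  cancel = solve 2 (λ q p → q :- p :+ p := q) refl

ratio : ℚ
ratio = + 1375 / 1000

8x≤11y⇒x≤ratio*y : ∀ {x y} → ι 8 ℚ.* x ℚ.≤ ι 11 ℚ.* y → x ℚ.≤ ratio ℚ.* y
-- `ι 8 ℚ.* ratio` computes to `ι 11`, so `h` only has to be reassociated.
8x≤11y⇒x≤ratio*y {x} {y} h = ℚ.*-cancelˡ-≤-pos (ι 8) (subst (ι 8 ℚ.* x ℚ.≤_) (ℚ.*-assoc (ι 8) ratio y) h)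

-- The constants come from ratio * L − a = (4L − a − 2b) + 2(b − ratio * L) + L/8, and
-- from ratio * L − a = ½((4L − 2a − b) + (b − ratio * L)) + L/16 in alternative₂.
alternative₁ : ∀ {a b L} → 0ℚ ℚ.≤ L → a ℚ.+ ι 2 ℚ.* b ℚ.≤ ι 4 ℚ.* L → ratio ℚ.* L ℚ.≤ b →
  a ℚ.≤ ratio ℚ.* L
alternative₁ {a} {b} {L} 0≤L h big = 0≤q-p⇒p≤q (subst (0ℚ ℚ.≤_) (identity a b L)
  (ℚ.+-mono-≤ (ℚ.+-mono-≤ (0≤q-p h) (*-monoˡ-≤ {r = ι 2} (ι-nonneg 2) (0≤q-p big)))
    (*-monoˡ-≤ {r = + 1 / 8} (ℚ.nonNegative⁻¹ (+ 1 / 8)) 0≤L)))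
  where
  open +-*-Solver
  identity : ∀ a b L →
    ι 4 ℚ.* L ℚ.- (a ℚ.+ ι 2 ℚ.* b) ℚ.+ ι 2 ℚ.* (b ℚ.- ratio ℚ.* L) ℚ.+ (+ 1 / 8) ℚ.* L
    ≡ ratio ℚ.* L ℚ.- a
  identity = solve 3 (λ a b L →
    con (ι 4) :* L :- (a :+ con (ι 2) :* b) :+ con (ι 2) :* (b :- con ratio :* L)
      :+ con (+ 1 / 8) :* L := con ratio :* L :- a) refl

alternative₂ : ∀ {a b L} → 0ℚ ℚ.≤ L → ι 2 ℚ.* a ℚ.+ b ℚ.≤ ι 4 ℚ.* L → ratio ℚ.* L ℚ.≤ b →
  a ℚ.≤ ratio ℚ.* L
alternative₂ {a} {b} {L} 0≤L h big = 0≤q-p⇒p≤q (subst (0ℚ ℚ.≤_) (identity a b L)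
  (ℚ.+-mono-≤ (*-monoˡ-≤ {r = ½} (ℚ.nonNegative⁻¹ ½) (ℚ.+-mono-≤ (0≤q-p h) (0≤q-p big)))
    (*-monoˡ-≤ {r = + 1 / 16} (ℚ.nonNegative⁻¹ (+ 1 / 16)) 0≤L)))
  where
  open +-*-Solver
  identity : ∀ a b L →
    ½ ℚ.* (ι 4 ℚ.* L ℚ.- (ι 2 ℚ.* a ℚ.+ b) ℚ.+ (b ℚ.- ratio ℚ.* L)) ℚ.+ (+ 1 / 16) ℚ.* L
    ≡ ratio ℚ.* L ℚ.- a
  identity = solve 3 (λ a b L →
    con ½ :* (con (ι 4) :* L :- (con (ι 2) :* a :+ b) :+ (b :- con ratio :* L))
      :+ con (+ 1 / 16) :* L := con ratio :* L :- a) refl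

-- The theorem for rational sizes

module _ (q : ℕ → ℚ) (n : ℕ)
         (nonincreasing : ∀ k → q (suc k) ℚ.≤ q k) (nonnegative : ∀ k → 0ℚ ℚ.≤ q k) where

  open Weighted q n

  private
    mono : ∀ {w v} → w ≼ v → ⟨ w ⟩ ℚ.≤ ⟨ v ⟩
    mono = ⟨⟩-mono nonincreasing nonnegative

  -- `s` is any solution and `L` any bound on its loads, so that later `L` can be one approximation
  -- of a real completion time.
  module _ (s : Solution 4) (L : ℚ) (loads≤L : ∀ i → ⟨ share s i ⟩ ℚ.≤ L) where

    first≤L : ⟨ δ₁ ⟩ ℚ.≤ L
    first≤L = ℚ.≤-trans (mono (δ₁-≼ s)) (loads≤L (s 1))

    fourth+fifth≤L : ⟨ δ₄₅ ⟩ ℚ.≤ L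
    fourth+fifth≤L with i , h ← δ₄₅-≼ s = ℚ.≤-trans (mono h) (loads≤L i)

    total≤4L : ⟨ all ⟩ ℚ.≤ ι 4 ℚ.* L
    total≤4L = begin
      ⟨ all ⟩
        ≤⟨ mono (all-≼ s) ⟩
      ⟨ shares s ⟩
        ≡⟨ ⟨⟩-+ (λ k → share s 0F k ℕ.+ share s 1F k) (λ k → share s 2F k ℕ.+ share s 3F k) ⟩
      ⟨ (λ k → share s 0F k ℕ.+ share s 1F k) ⟩ ℚ.+ ⟨ (λ k → share s 2F k ℕ.+ share s 3F k) ⟩
        ≡⟨ cong₂ ℚ._+_ (⟨⟩-+ (share s 0F) (share s 1F)) (⟨⟩-+ (share s 2F) (share s 3F)) ⟩
      (⟨ share s 0F ⟩ ℚ.+ ⟨ share s 1F ⟩) ℚ.+ (⟨ share s 2F ⟩ ℚ.+ ⟨ share s 3F ⟩)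
        ≤⟨ ℚ.+-mono-≤ (ℚ.+-mono-≤ (loads≤L 0F) (loads≤L 1F)) (ℚ.+-mono-≤ (loads≤L 2F) (loads≤L 3F)) ⟩
      (L ℚ.+ L) ℚ.+ (L ℚ.+ L)
        ≡⟨ quadruple L ⟩
      ι 4 ℚ.* L ∎
      where
      open ℚ.≤-Reasoning
      open +-*-Solver
      quadruple : ∀ L → (L ℚ.+ L) ℚ.+ (L ℚ.+ L) ≡ ι 4 ℚ.* L
      quadruple = solve 1 (λ L → (L :+ L) :+ (L :+ L) := con (ι 4) :* L) refl

    0≤L : 0ℚ ℚ.≤ L
    0≤L = begin
      0ℚ                        ≡⟨ ℚ.*-zeroˡ ⟨ δ₁ ⟩ ⟨
      -- Zero is written as the value of a zero weight so that `mono` can compare it with the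
      -- largest size.
      0ℚ ℚ.* ⟨ δ₁ ⟩             ≡⟨ ⟨⟩-* 0 δ₁ ⟨
      ⟨ (λ k → 0 ℕ.* δ₁ k) ⟩    ≤⟨ mono (pointwise-≼ {v = δ₁} (λ _ → ℕ.z≤n)) ⟩
      ⟨ δ₁ ⟩                    ≤⟨ first≤L ⟩
      L                         ∎
      where open ℚ.≤-Reasoning

    total+first : ∀ w → (λ k → 8 ℕ.* w k) ≼ (λ k → all k ℕ.+ 7 ℕ.* δ₁ k) →
      ⟨ w ⟩ ℚ.≤ ratio ℚ.* L
    total+first w h = 8x≤11y⇒x≤ratio*y {y = L} (begin
      ι 8 ℚ.* ⟨ w ⟩                              ≡⟨ ⟨⟩-* 8 w ⟨
      ⟨ (λ k → 8 ℕ.* w k) ⟩                      ≤⟨ mono h ⟩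
      ⟨ (λ k → all k ℕ.+ 7 ℕ.* δ₁ k) ⟩           ≡⟨ ⟨⟩-+ all (λ k → 7 ℕ.* δ₁ k) ⟩
      ⟨ all ⟩ ℚ.+ ⟨ (λ k → 7 ℕ.* δ₁ k) ⟩         ≡⟨ cong (⟨ all ⟩ ℚ.+_) (⟨⟩-* 7 δ₁) ⟩
      ⟨ all ⟩ ℚ.+ ι 7 ℚ.* ⟨ δ₁ ⟩                 ≤⟨ ℚ.+-mono-≤ total≤4L (*-monoˡ-≤ (ι-nonneg 7) first≤L) ⟩
      ι 4 ℚ.* L ℚ.+ ι 7 ℚ.* L                    ≡⟨ ℚ.*-distribʳ-+ L (ι 4) (ι 7) ⟨
      ι 11 ℚ.* L                                 ∎)
      where open ℚ.≤-Reasoning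

    load-3₂ : ⟨ share solution₂ 2F ⟩ ℚ.≤ ratio ℚ.* L
    load-3₂ = 8x≤11y⇒x≤ratio*y {y = L} (begin
      ι 8 ℚ.* ⟨ share solution₂ 2F ⟩
        ≡⟨ ⟨⟩-* 8 (share solution₂ 2F) ⟨
      ⟨ (λ k → 8 ℕ.* share solution₂ 2F k) ⟩
        ≤⟨ mono bound-3₂ ⟩
      ⟨ (λ k → 2 ℕ.* all k ℕ.+ (2 ℕ.* δ₁ k ℕ.+ δ₄₅ k)) ⟩
        ≡⟨ ⟨⟩-+ (λ k → 2 ℕ.* all k) (λ k → 2 ℕ.* δ₁ k ℕ.+ δ₄₅ k) ⟩
      ⟨ (λ k → 2 ℕ.* all k) ⟩ ℚ.+ ⟨ (λ k → 2 ℕ.* δ₁ k ℕ.+ δ₄₅ k) ⟩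
        ≡⟨ cong₂ ℚ._+_ (⟨⟩-* 2 all) (⟨⟩-+ (λ k → 2 ℕ.* δ₁ k) δ₄₅) ⟩
      ι 2 ℚ.* ⟨ all ⟩ ℚ.+ (⟨ (λ k → 2 ℕ.* δ₁ k) ⟩ ℚ.+ ⟨ δ₄₅ ⟩)
        ≡⟨ cong (λ a → ι 2 ℚ.* ⟨ all ⟩ ℚ.+ (a ℚ.+ ⟨ δ₄₅ ⟩)) (⟨⟩-* 2 δ₁) ⟩
      ι 2 ℚ.* ⟨ all ⟩ ℚ.+ (ι 2 ℚ.* ⟨ δ₁ ⟩ ℚ.+ ⟨ δ₄₅ ⟩)
        ≤⟨ ℚ.+-mono-≤ (*-monoˡ-≤ (ι-nonneg 2) total≤4L)
             (ℚ.+-mono-≤ (*-monoˡ-≤ (ι-nonneg 2) first≤L) fourth+fifth≤L) ⟩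
      ι 2 ℚ.* (ι 4 ℚ.* L) ℚ.+ (ι 2 ℚ.* L ℚ.+ L)
        ≡⟨ collect L ⟩
      ι 11 ℚ.* L ∎)
      where
      open ℚ.≤-Reasoning
      open +-*-Solver
      collect : ∀ L → ι 2 ℚ.* (ι 4 ℚ.* L) ℚ.+ (ι 2 ℚ.* L ℚ.+ L) ≡ ι 11 ℚ.* L
      collect = solve 1 (λ L →
        con (ι 2) :* (con (ι 4) :* L) :+ (con (ι 2) :* L :+ L) := con (ι 11) :* L) refl

    load-4₂ : ⟨ share solution₂ 3F ⟩ ℚ.≤ ratio ℚ.* L
    load-4₂ = 8x≤11y⇒x≤ratio*y {y = L} (begin
      ι 8 ℚ.* ⟨ share solution₂ 3F ⟩
        ≡⟨ ⟨⟩-* 8 (share solution₂ 3F) ⟨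
      ⟨ (λ k → 8 ℕ.* share solution₂ 3F k) ⟩
        ≤⟨ mono bound-4₂ ⟩
      ⟨ (λ k → 2 ℕ.* all k ℕ.+ 3 ℕ.* δ₄₅ k) ⟩
        ≡⟨ ⟨⟩-+ (λ k → 2 ℕ.* all k) (λ k → 3 ℕ.* δ₄₅ k) ⟩
      ⟨ (λ k → 2 ℕ.* all k) ⟩ ℚ.+ ⟨ (λ k → 3 ℕ.* δ₄₅ k) ⟩
        ≡⟨ cong₂ ℚ._+_ (⟨⟩-* 2 all) (⟨⟩-* 3 δ₄₅) ⟩
      ι 2 ℚ.* ⟨ all ⟩ ℚ.+ ι 3 ℚ.* ⟨ δ₄₅ ⟩
        ≤⟨ ℚ.+-mono-≤ (*-monoˡ-≤ (ι-nonneg 2) total≤4L) (*-monoˡ-≤ (ι-nonneg 3) fourth+fifth≤L) ⟩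
      ι 2 ℚ.* (ι 4 ℚ.* L) ℚ.+ ι 3 ℚ.* L
        ≡⟨ collect L ⟩
      ι 11 ℚ.* L ∎)
      where
      open ℚ.≤-Reasoning
      open +-*-Solver
      collect : ∀ L → ι 2 ℚ.* (ι 4 ℚ.* L) ℚ.+ ι 3 ℚ.* L ≡ ι 11 ℚ.* L
      collect = solve 1 (λ L →
        con (ι 2) :* (con (ι 4) :* L) :+ con (ι 3) :* L := con (ι 11) :* L) refl

    load-1₂ : ∀ b → (λ k → share solution₂ 0F k ℕ.+ 2 ℕ.* b k) ≼ all →
      ratio ℚ.* L ℚ.≤ ⟨ b ⟩ → ⟨ share solution₂ 0F ⟩ ℚ.≤ ratio ℚ.* L
    load-1₂ b h = alternative₁ {⟨ share solution₂ 0F ⟩} {⟨ b ⟩} {L} 0≤L (begin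
      ⟨ share solution₂ 0F ⟩ ℚ.+ ι 2 ℚ.* ⟨ b ⟩
        ≡⟨ cong (⟨ share solution₂ 0F ⟩ ℚ.+_) (⟨⟩-* 2 b) ⟨
      ⟨ share solution₂ 0F ⟩ ℚ.+ ⟨ (λ k → 2 ℕ.* b k) ⟩
        ≡⟨ ⟨⟩-+ (share solution₂ 0F) (λ k → 2 ℕ.* b k) ⟨
      ⟨ (λ k → share solution₂ 0F k ℕ.+ 2 ℕ.* b k) ⟩
        ≤⟨ mono h ⟩
      ⟨ all ⟩
        ≤⟨ total≤4L ⟩
      ι 4 ℚ.* L ∎)
      where open ℚ.≤-Reasoning

    load-2₂ : ∀ b → (λ k → 2 ℕ.* share solution₂ 1F k ℕ.+ b k) ≼ all →
      ratio ℚ.* L ℚ.≤ ⟨ b ⟩ → ⟨ share solution₂ 1F ⟩ ℚ.≤ ratio ℚ.* L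
    load-2₂ b h = alternative₂ {⟨ share solution₂ 1F ⟩} {⟨ b ⟩} {L} 0≤L (begin
      ι 2 ℚ.* ⟨ share solution₂ 1F ⟩ ℚ.+ ⟨ b ⟩
        ≡⟨ cong (ℚ._+ ⟨ b ⟩) (⟨⟩-* 2 (share solution₂ 1F)) ⟨
      ⟨ (λ k → 2 ℕ.* share solution₂ 1F k) ⟩ ℚ.+ ⟨ b ⟩
        ≡⟨ ⟨⟩-+ (λ k → 2 ℕ.* share solution₂ 1F k) b ⟨
      ⟨ (λ k → 2 ℕ.* share solution₂ 1F k ℕ.+ b k) ⟩
        ≤⟨ mono h ⟩
      ⟨ all ⟩
        ≤⟨ total≤4L ⟩
      ι 4 ℚ.* L ∎)
      where open ℚ.≤-Reasoning

    loads-solution₂ : ∀ b →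
      (λ k → share solution₂ 0F k ℕ.+ 2 ℕ.* b k) ≼ all →
      (λ k → 2 ℕ.* share solution₂ 1F k ℕ.+ b k) ≼ all →
      ratio ℚ.* L ℚ.≤ ⟨ b ⟩ → ∀ i → ⟨ share solution₂ i ⟩ ℚ.≤ ratio ℚ.* L
    loads-solution₂ b h₁ h₂ big 0F = load-1₂ b h₁ big
    loads-solution₂ b h₁ h₂ big 1F = load-2₂ b h₂ big
    loads-solution₂ b h₁ h₂ big 2F = load-3₂
    loads-solution₂ b h₁ h₂ big 3F = load-4₂

    -- The case distinction is made on rationals, whose order is decidable, unlike that of the
    -- reals. Which solution is good may change with the approximation index; this is harmless
    -- because the makespan takes its minimum index by index.
    good-solution : (∀ i → ⟨ share solution₁ i ⟩ ℚ.≤ ratio ℚ.* L)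
                  ⊎ (∀ i → ⟨ share solution₂ i ⟩ ℚ.≤ ratio ℚ.* L)
    good-solution = go (ℚ.≤-total ⟨ share solution₁ 2F ⟩ (ratio ℚ.* L))
                       (ℚ.≤-total ⟨ share solution₁ 3F ⟩ (ratio ℚ.* L))
      where
      go : ⟨ share solution₁ 2F ⟩ ℚ.≤ ratio ℚ.* L ⊎ ratio ℚ.* L ℚ.≤ ⟨ share solution₁ 2F ⟩ →
           ⟨ share solution₁ 3F ⟩ ℚ.≤ ratio ℚ.* L ⊎ ratio ℚ.* L ℚ.≤ ⟨ share solution₁ 3F ⟩ →
           (∀ i → ⟨ share solution₁ i ⟩ ℚ.≤ ratio ℚ.* L) ⊎
           (∀ i → ⟨ share solution₂ i ⟩ ℚ.≤ ratio ℚ.* L)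
      go (inj₂ big) _ = inj₂ (loads-solution₂ (share solution₁ 2F) bound-1₂3₁ bound-2₂3₁ big)
      go (inj₁ _) (inj₂ big) = inj₂ (loads-solution₂ (share solution₁ 3F) bound-1₂4₁ bound-2₂4₁ big)
      go (inj₁ h₃) (inj₁ h₄) = inj₁ λ where
        0F → total+first (share solution₁ 0F) bound-1₁
        1F → total+first (share solution₁ 1F) bound-2₁
        2F → h₃
        3F → h₄

-- The order on the reals

Eventually : (ℕ → Set) → Set
Eventually P = ∃ λ N → ∀ n → N ℕ.≤ n → P n

eventually₂ : ∀ {P Q R : ℕ → Set} → (∀ n → P n → Q n → R n) →
  Eventually P → Eventually Q → Eventually R
eventually₂ f (M , p) (N , q) = M ℕ.⊔ N , λ n h →
  f n (p n (ℕ.m⊔n≤o⇒m≤o M N h)) (q n (ℕ.m⊔n≤o⇒n≤o M N h))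

pointwise-≤ : ∀ {x y} → (∀ n → seq x n ℚ.≤ seq y n) → x ≤ y
pointwise-≤ {x} {y} x≤y ε 0<ε = 0 , λ n _ → begin
  seq x n               ≤⟨ x≤y n ⟩
  seq y n               ≡⟨ ℚ.+-identityʳ (seq y n) ⟨
  seq y n ℚ.+ 0ℚ        ≤⟨ ℚ.+-monoʳ-≤ (seq y n) (ℚ.<⇒≤ 0<ε) ⟩
  seq y n ℚ.+ ε         ∎
  where open ℚ.≤-Reasoning

≤-refl : ∀ {x} → x ≤ x
≤-refl {x} = pointwise-≤ {x} {x} (λ _ → ℚ.≤-refl)

+-halves : ∀ p ε → p ℚ.+ ½ ℚ.* ε ℚ.+ ½ ℚ.* ε ≡ p ℚ.+ ε
+-halves p ε = trans (ℚ.+-assoc p (½ ℚ.* ε) (½ ℚ.* ε)) (cong (p ℚ.+_) (½p+½p ε))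

≤-trans : ∀ {x y z} → x ≤ y → y ≤ z → x ≤ z
≤-trans {x} {y} {z} x≤y y≤z ε 0<ε = eventually₂ step (x≤y δ (0<½p 0<ε)) (y≤z δ (0<½p 0<ε))
  where
  δ : ℚ
  δ = ½ ℚ.* ε
  step : ∀ n → seq x n ℚ.≤ seq y n ℚ.+ δ → seq y n ℚ.≤ seq z n ℚ.+ δ → seq x n ℚ.≤ seq z n ℚ.+ ε
  step n p q = ℚ.≤-trans p (ℚ.≤-trans (ℚ.+-monoˡ-≤ δ q) (ℚ.≤-reflexive (+-halves (seq z n) ε)))

+-mono-≤ : ∀ {x y u v} → x ≤ y → u ≤ v → x + u ≤ y + v
+-mono-≤ {x} {y} {u} {v} x≤y u≤v ε 0<ε = eventually₂ step (x≤y δ (0<½p 0<ε)) (u≤v δ (0<½p 0<ε))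
  where
  δ : ℚ
  δ = ½ ℚ.* ε
  open +-*-Solver
  regroup : ∀ a b d → (a ℚ.+ d) ℚ.+ (b ℚ.+ d) ≡ (a ℚ.+ b) ℚ.+ d ℚ.+ d
  regroup = solve 3 (λ a b d → (a :+ d) :+ (b :+ d) := (a :+ b) :+ d :+ d) refl
  step : ∀ n → seq x n ℚ.≤ seq y n ℚ.+ δ → seq u n ℚ.≤ seq v n ℚ.+ δ →
    seq x n ℚ.+ seq u n ℚ.≤ (seq y n ℚ.+ seq v n) ℚ.+ ε
  step n p q = ℚ.≤-trans (ℚ.+-mono-≤ p q) (ℚ.≤-reflexive
    (trans (regroup (seq y n) (seq v n) δ) (+-halves (seq y n ℚ.+ seq v n) ε)))

⊔-lub : ∀ {x y z} → x ≤ z → y ≤ z → x ⊔ y ≤ z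
⊔-lub x≤z y≤z ε 0<ε = eventually₂ (λ _ → ℚ.⊔-lub) (x≤z ε 0<ε) (y≤z ε 0<ε)

x≤x⊔y : ∀ x y → x ≤ x ⊔ y
x≤x⊔y x y = pointwise-≤ {x} {x ⊔ y} λ n → ℚ.p≤p⊔q (seq x n) (seq y n)

y≤x⊔y : ∀ x y → y ≤ x ⊔ y
y≤x⊔y x y = pointwise-≤ {y} {x ⊔ y} λ n → ℚ.p≤q⊔p (seq x n) (seq y n)

⊓-mono-≤ : ∀ {x y u v} → x ≤ y → u ≤ v → x ⊓ u ≤ y ⊓ v
⊓-mono-≤ {x} {y} {u} {v} x≤y u≤v ε 0<ε = eventually₂ step (x≤y ε 0<ε) (u≤v ε 0<ε)
  where
  step : ∀ n → seq x n ℚ.≤ seq y n ℚ.+ ε → seq u n ℚ.≤ seq v n ℚ.+ ε →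
    seq x n ℚ.⊓ seq u n ℚ.≤ seq y n ℚ.⊓ seq v n ℚ.+ ε
  step n p q = [ (λ eq → subst (λ a → seq x n ℚ.⊓ seq u n ℚ.≤ a ℚ.+ ε) (sym eq)
                   (ℚ.≤-trans (ℚ.p⊓q≤p (seq x n) (seq u n)) p))
               , (λ eq → subst (λ a → seq x n ℚ.⊓ seq u n ℚ.≤ a ℚ.+ ε) (sym eq)
                   (ℚ.≤-trans (ℚ.p⊓q≤q (seq x n) (seq u n)) q))
               ]′ (ℚ.⊓-sel (seq y n) (seq v n))

fromℚ-*-monoˡ-≤ : ∀ {c x y} → 0ℚ ℚ.< c → x ≤ y → fromℚ c * x ≤ fromℚ c * y
fromℚ-*-monoˡ-≤ {c} {x} {y} 0<c x≤y ε 0<ε with δ , 0<δ , cδ≡ε ← quotient 0<c 0<ε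
  with N , h ← x≤y δ 0<δ = N , λ n N≤n → begin
    c ℚ.* seq x n                 ≤⟨ *-monoˡ-≤ (ℚ.<⇒≤ 0<c) (h n N≤n) ⟩
    c ℚ.* (seq y n ℚ.+ δ)         ≡⟨ ℚ.*-distribˡ-+ c (seq y n) δ ⟩
    c ℚ.* seq y n ℚ.+ c ℚ.* δ     ≡⟨ cong (c ℚ.* seq y n ℚ.+_) cδ≡ε ⟩
    c ℚ.* seq y n ℚ.+ ε           ∎
  where open ℚ.≤-Reasoning

-- The threshold comes from the Cauchy moduli of `x` and `y` alone, not from the doubly negated
-- hypothesis. What remains is a rational inequality, which is decidable, so the hypothesis may be
-- opened to prove it. This matches the double negation in the attainment of the optimum.
≤-stable : ∀ {x y} → ¬ ¬ (x ≤ y) → x ≤ y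
≤-stable {x} {y} ¬¬x≤y ε 0<ε = Nx ℕ.⊔ Ny , λ n N≤n →
  decidable-stable (seq x n ℚ.≤? seq y n ℚ.+ ε) λ x≰y → ¬¬x≤y λ x≤y →
    x≰y (transfer n (ℕ.m⊔n≤o⇒m≤o Nx Ny N≤n) (ℕ.m⊔n≤o⇒n≤o Nx Ny N≤n) (x≤y δ 0<δ))
  where
  δ γ : ℚ
  δ = ½ ℚ.* ε
  -- Moving `x` and `y` between the indices `n` and `m` costs `γ` each and the comparison at `m`
  -- costs `δ`: in total `ε`.
  γ = ½ ℚ.* δ
  0<δ : 0ℚ ℚ.< δ
  0<δ = 0<½p 0<ε
  Nx Ny : ℕ
  Nx = proj₁ (cauchy x γ (0<½p 0<δ))
  Ny = proj₁ (cauchy y γ (0<½p 0<δ))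

  near : ∀ p q → ℚ.∣ p ℚ.- q ∣ ℚ.≤ γ → p ℚ.≤ q ℚ.+ γ
  near p q h = ℚ.≤-trans (p≤q+∣p-q∣ p q) (ℚ.+-monoʳ-≤ q h)

  regroup : ∀ a b c → a ℚ.+ b ℚ.+ c ℚ.+ b ≡ a ℚ.+ c ℚ.+ b ℚ.+ b
  regroup = solve 3 (λ a b c → a :+ b :+ c :+ b := a :+ c :+ b :+ b) refl
    where open +-*-Solver

  transfer : ∀ n → Nx ℕ.≤ n → Ny ℕ.≤ n → Eventually (λ m → seq x m ℚ.≤ seq y m ℚ.+ δ) →
    seq x n ℚ.≤ seq y n ℚ.+ ε
  transfer n Nx≤n Ny≤n (M , x≤y) = begin
    seq x n                     ≤⟨ near (seq x n) (seq x m)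
                                     (proj₂ (cauchy x γ (0<½p 0<δ)) n m Nx≤n (ℕ.≤-trans Nx≤n n≤m)) ⟩
    seq x m ℚ.+ γ               ≤⟨ ℚ.+-monoˡ-≤ γ (x≤y m (ℕ.m≤n⊔m n M)) ⟩
    seq y m ℚ.+ δ ℚ.+ γ         ≤⟨ ℚ.+-monoˡ-≤ γ (ℚ.+-monoˡ-≤ δ (near (seq y m) (seq y n)
                                     (proj₂ (cauchy y γ (0<½p 0<δ)) m n (ℕ.≤-trans Ny≤n n≤m) Ny≤n))) ⟩
    seq y n ℚ.+ γ ℚ.+ δ ℚ.+ γ   ≡⟨ regroup (seq y n) γ δ ⟩
    seq y n ℚ.+ δ ℚ.+ γ ℚ.+ γ   ≡⟨ +-halves (seq y n ℚ.+ δ) δ ⟩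
    seq y n ℚ.+ δ ℚ.+ δ         ≡⟨ +-halves (seq y n) ε ⟩
    seq y n ℚ.+ ε               ∎
    where
    open ℚ.≤-Reasoning
    m : ℕ
    m = n ℕ.⊔ M
    n≤m : n ℕ.≤ m
    n≤m = ℕ.m≤m⊔n n M

-- Once `seq y n` is at least `α`, the truncation in `recip` has no effect. The hypothesis is used
-- with error `ε ℚ.* α`, at most `ε` times the denominator, so dividing leaves an error of at most
-- `ε`.
÷-≤ : ∀ {c x y} (0<y : 0ℝ < y) → x ≤ fromℚ c * y → x ÷ y ⟨ 0<y ⟩ ≤ fromℚ c
÷-≤ {c} {x} {y} (α , 0<α , α≤y) x≤cy ε 0<ε =
  eventually₂ step α≤y (x≤cy (ε ℚ.* α) (0<p*q 0<ε 0<α))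
  where
  open ℚ.≤-Reasoning
  step : ∀ n → 0ℚ ℚ.+ α ℚ.≤ seq y n → seq x n ℚ.≤ c ℚ.* seq y n ℚ.+ ε ℚ.* α →
    seq x n ℚ.* 1/⊔ (seq y n) 0<α ℚ.≤ c ℚ.+ ε
  step n α≤yₙ xₙ≤ = begin
    seq x n ℚ.* u
      ≤⟨ ℚ.*-monoʳ-≤-nonNeg u {{ℚ.nonNegative (ℚ.<⇒≤ 0<u)}} xₙ≤[c+ε]a ⟩
    (c ℚ.+ ε) ℚ.* a ℚ.* u
      ≡⟨ ℚ.*-assoc (c ℚ.+ ε) a u ⟩
    (c ℚ.+ ε) ℚ.* (a ℚ.* u)
      ≡⟨ cong ((c ℚ.+ ε) ℚ.*_) (ℚ.*-inverseʳ a {{p⊔ε≢0 (seq y n) 0<α}}) ⟩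
    (c ℚ.+ ε) ℚ.* 1ℚ
      ≡⟨ ℚ.*-identityʳ (c ℚ.+ ε) ⟩
    c ℚ.+ ε ∎
    where
    a u : ℚ
    a = seq y n ℚ.⊔ α
    u = 1/⊔ (seq y n) 0<α
    0<u : 0ℚ ℚ.< u
    0<u = ℚ.positive⁻¹ u {{ℚ.1/pos⇒pos a {{ℚ.positive (0<p⊔ε (seq y n) 0<α)}}}}
    a≡yₙ : a ≡ seq y n
    a≡yₙ = ℚ.p≥q⇒p⊔q≡p (subst (ℚ._≤ seq y n) (ℚ.+-identityˡ α) α≤yₙ)
    xₙ≤[c+ε]a : seq x n ℚ.≤ (c ℚ.+ ε) ℚ.* a
    xₙ≤[c+ε]a = begin
      seq x n                           ≤⟨ xₙ≤ ⟩
      c ℚ.* seq y n ℚ.+ ε ℚ.* α         ≡⟨ cong (λ b → c ℚ.* b ℚ.+ ε ℚ.* α) a≡yₙ ⟨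
      c ℚ.* a ℚ.+ ε ℚ.* α               ≤⟨ ℚ.+-monoʳ-≤ (c ℚ.* a) (*-monoˡ-≤ (ℚ.<⇒≤ 0<ε)
                                             (ℚ.p≤q⊔p (seq y n) α)) ⟩
      c ℚ.* a ℚ.+ ε ℚ.* a               ≡⟨ ℚ.*-distribʳ-+ a c ε ⟨
      (c ℚ.+ ε) ℚ.* a                   ∎

-- Sums, maxima and suffix maxima of reals

sum-mono-≤ : ∀ {f g} n → (∀ k → k ℕ.< n → f k ≤ g k) → sum n f ≤ sum n g
sum-mono-≤ zero    f≤g = ≤-refl {0ℝ}
sum-mono-≤ {f} {g} (suc n) f≤g = +-mono-≤ {sum n f} {sum n g} {f n} {g n}
  (sum-mono-≤ n (λ k k<n → f≤g k (ℕ.m<n⇒m<1+n k<n))) (f≤g n (ℕ.n<1+n n))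

maximum-mono-≤ : ∀ {m} {f g : Fin (suc m) → ℝ} → (∀ i → f i ≤ g i) → maximum f ≤ maximum g
maximum-mono-≤ {zero}          f≤g = f≤g zero
maximum-mono-≤ {suc m} {f} {g} f≤g = ⊔-lub {f zero} {maximum (f ∘ suc)} {maximum g}
  (≤-trans {f zero} {g zero} {maximum g} (f≤g zero) (x≤x⊔y (g zero) (maximum (g ∘ suc))))
  (≤-trans {maximum (f ∘ suc)} {maximum (g ∘ suc)} {maximum g}
    (maximum-mono-≤ (f≤g ∘ suc)) (y≤x⊔y (g zero) (maximum (g ∘ suc))))

seq-≤-maximum : ∀ {m} (f : Fin (suc m) → ℝ) i n → seq (f i) n ℚ.≤ seq (maximum f) n
seq-≤-maximum {zero}  f zero    n = ℚ.≤-refl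
seq-≤-maximum {suc m} f zero    n = ℚ.p≤p⊔q (seq (f zero) n) (seq (maximum (f ∘ suc)) n)
seq-≤-maximum {suc m} f (suc i) n = ℚ.≤-trans (seq-≤-maximum (f ∘ suc) i n)
  (ℚ.p≤q⊔p (seq (f zero) n) (seq (maximum (f ∘ suc)) n))

seq-maximum-lub : ∀ {m} (f : Fin (suc m) → ℝ) {b} n →
  (∀ i → seq (f i) n ℚ.≤ b) → seq (maximum f) n ℚ.≤ b
seq-maximum-lub {zero}  f n f≤b = f≤b zero
seq-maximum-lub {suc m} f n f≤b = ℚ.⊔-lub (f≤b zero) (seq-maximum-lub (f ∘ suc) n (f≤b ∘ suc))

-- The maximum of 0 and the x j with k ≤ j < b.
envelope : ℕ → (ℕ → ℝ) → ℕ → ℝ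
envelope zero    x k       = 0ℝ
envelope (suc b) x zero    = x 0 ⊔ envelope b (x ∘ suc) 0
envelope (suc b) x (suc k) = envelope b (x ∘ suc) k

seq-envelope-nonincreasing : ∀ b x n k →
  seq (envelope b x (suc k)) n ℚ.≤ seq (envelope b x k) n
seq-envelope-nonincreasing zero    x n k       = ℚ.≤-refl
seq-envelope-nonincreasing (suc b) x n zero    =
  ℚ.p≤q⊔p (seq (x 0) n) (seq (envelope b (x ∘ suc) 0) n)
seq-envelope-nonincreasing (suc b) x n (suc k) = seq-envelope-nonincreasing b (x ∘ suc) n k

seq-envelope-nonnegative : ∀ b x n k → 0ℚ ℚ.≤ seq (envelope b x k) n
seq-envelope-nonnegative zero    x n k       = ℚ.≤-refl
seq-envelope-nonnegative (suc b) x n zero    =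
  ℚ.≤-trans (seq-envelope-nonnegative b (x ∘ suc) n 0)
    (ℚ.p≤q⊔p (seq (x 0) n) (seq (envelope b (x ∘ suc) 0) n))
seq-envelope-nonnegative (suc b) x n (suc k) = seq-envelope-nonnegative b (x ∘ suc) n k

≤-envelope : ∀ b x {k} → k ℕ.< b → x k ≤ envelope b x k
≤-envelope (suc b) x {zero}  _         = x≤x⊔y (x 0) (envelope b (x ∘ suc) 0)
≤-envelope (suc b) x {suc k} (ℕ.s≤s h) = ≤-envelope b (x ∘ suc) h

-- The first entry of a suffix of a nonincreasing sequence is its maximum. From `b` on the envelope
-- is zero, and nonnegativity suffices.
envelope-≤ : ∀ b x → (∀ k → x (suc k) ≤ x k) → (∀ k → 0ℝ ≤ x k) → ∀ k → envelope b x k ≤ x k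
envelope-≤ zero    x dec pos k       = pos k
envelope-≤ (suc b) x dec pos zero    = ⊔-lub {x 0} {envelope b (x ∘ suc) 0} {x 0} (≤-refl {x 0})
  (≤-trans {envelope b (x ∘ suc) 0} {x 1} {x 0}
    (envelope-≤ b (x ∘ suc) (dec ∘ suc) (pos ∘ suc) 0) (dec 0))
envelope-≤ (suc b) x dec pos (suc k) = envelope-≤ b (x ∘ suc) (dec ∘ suc) (pos ∘ suc) k

-- From rational approximations to realizations

module _ {m} (s : Solution (suc m)) (b : ℕ) where

  -- `load` with the sizes as a parameter, so that the envelope can be inserted; for the sizes of a
  -- realization it unfolds to `load` itself.
  loadOf : (ℕ → ℝ) → Fin (suc m) → ℝ
  loadOf x i = sum b λ k → if does (s (suc k) ≟ i) then x k else 0ℝ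

  completion : (ℕ → ℝ) → ℝ
  completion x = maximum (loadOf x)

  completion-mono-≤ : ∀ {x y} → (∀ k → k ℕ.< b → x k ≤ y k) → completion x ≤ completion y
  completion-mono-≤ {x} {y} x≤y = maximum-mono-≤ {f = loadOf x} {loadOf y} λ i →
    sum-mono-≤ b λ k k<b → branch (does (s (suc k) ≟ i)) k k<b
    where
    branch : ∀ c k → k ℕ.< b → (if c then x k else 0ℝ) ≤ (if c then y k else 0ℝ)
    branch true  k k<b = x≤y k k<b
    branch false k k<b = ≤-refl {0ℝ}

  seq-loadOf : ∀ x i n → seq (loadOf x i) n ≡ Weighted.⟨_⟩ (λ k → seq (x k) n) b (share s i)
  seq-loadOf x i n = go b
    where
    branch : ∀ c k → seq (if c then x k else 0ℝ) n ≡ ι (if c then 1 else 0) ℚ.* seq (x k) n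
    branch true  k = sym (ℚ.*-identityˡ (seq (x k) n))
    branch false k = sym (ℚ.*-zeroˡ (seq (x k) n))
    go : ∀ b → seq (sum b λ k → if does (s (suc k) ≟ i) then x k else 0ℝ) n
             ≡ Weighted.⟨_⟩ (λ k → seq (x k) n) b (share s i)
    go zero    = refl
    go (suc b) = cong₂ ℚ._+_ (go b) (branch (does (s (suc b) ≟ i)) b)

-- At each index the approximations of the envelope are exactly nonincreasing and nonnegative, so
-- `good-solution` applies there, with the approximation of the completion time of `s` as the bound
-- on its loads.
makespan-envelope : ∀ b x (s : Solution 4) →
  completion solution₁ b (envelope b x) ⊓ completion solution₂ b (envelope b x)
    ≤ fromℚ ratio * completion s b (envelope b x)
makespan-envelope b x s = pointwise-≤
  {completion solution₁ b e ⊓ completion solution₂ b e} {fromℚ ratio * completion s b e}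
  λ n → [ (λ h → ℚ.≤-trans (ℚ.p⊓q≤p (C₁ n) (C₂ n)) (bounded-by n solution₁ h))
        , (λ h → ℚ.≤-trans (ℚ.p⊓q≤q (C₁ n) (C₂ n)) (bounded-by n solution₂ h))
        ]′ (good-solution (q n) b (seq-envelope-nonincreasing b x n)
             (seq-envelope-nonnegative b x n) s (L n) (loads≤L n))
  where
  e : ℕ → ℝ
  e = envelope b x
  q : ℕ → ℕ → ℚ
  q n k = seq (e k) n
  C₁ C₂ L : ℕ → ℚ
  C₁ = seq (completion solution₁ b e)
  C₂ = seq (completion solution₂ b e)
  L  = seq (completion s b e)
  loads≤L : ∀ n i → Weighted.⟨_⟩ (q n) b (share s i) ℚ.≤ L n
  loads≤L n i = subst (ℚ._≤ L n) (seq-loadOf s b e i n) (seq-≤-maximum (loadOf s b e) i n)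
  bounded-by : ∀ n (t : Solution 4) →
    (∀ i → Weighted.⟨_⟩ (q n) b (share t i) ℚ.≤ ratio ℚ.* L n) →
    seq (completion t b e) n ℚ.≤ ratio ℚ.* L n
  bounded-by n t h = seq-maximum-lub (loadOf t b e) n λ i →
    subst (ℚ._≤ ratio ℚ.* L n) (sym (seq-loadOf t b e i n)) (h i)

makespan-≤ : ∀ p (s : Solution 4) → makespan algorithm p ≤ fromℚ ratio * completionTime s p
makespan-≤ p s =
  ≤-trans {makespan algorithm p} {ct solution₁ e ⊓ ct solution₂ e} {fromℚ ratio * completionTime s p}
    -- The envelope replaces the sizes from above in the makespan and is replaced by them from above
    -- in the completion time of `s`; hence both inequalities between the two are used.
    (⊓-mono-≤ {ct solution₁ x} {ct solution₁ e} {ct solution₂ x} {ct solution₂ e}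
      (completion-mono-≤ solution₁ b (λ k → ≤-envelope b x))
      (completion-mono-≤ solution₂ b (λ k → ≤-envelope b x)))
    (≤-trans {ct solution₁ e ⊓ ct solution₂ e} {fromℚ ratio * ct s e} {fromℚ ratio * ct s x}
      (makespan-envelope b x s)
      (fromℚ-*-monoˡ-≤ {ratio} {ct s e} {ct s x} (ℚ.positive⁻¹ ratio)
        (completion-mono-≤ s b λ k _ → envelope-≤ b x
          (λ k → nonincreasing p (suc k)) (λ k → nonnegative p (suc k)) k)))
  where
  b : ℕ
  b = bound p
  x e : ℕ → ℝ
  x k = size p (suc k)
  e = envelope b x
  ct : Solution 4 → (ℕ → ℝ) → ℝ
  ct s = completion s b

theorem5 : CompetitiveRatioAtMost algorithm (fromℚ (+ 1375 / 1000))
theorem5 p λ* (_ , attained) 0<λ* = ÷-≤ {ratio} {makespan algorithm p} {λ*} 0<λ*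
  -- Stability of the goal allows an optimal `s` to be extracted from the doubly negated attainment.
  (≤-stable {makespan algorithm p} {fromℚ ratio * λ*} λ ¬bound → attained λ (s , s≤λ* , _) →
    ¬bound (≤-trans {makespan algorithm p} {fromℚ ratio * completionTime s p} {fromℚ ratio * λ*}
      (makespan-≤ p s)
      (fromℚ-*-monoˡ-≤ {ratio} {completionTime s p} {λ*} (ℚ.positive⁻¹ ratio) s≤λ*)))
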